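{- Let $\mathbb{F}\subset\mathbb{K}$ be fields of characteristic zero, let $n$ be a positive integer, let $\kappa\in\mathbb{K}$, and let $f\colon\mathbb{F}\to\mathbb{K}$ be a generalized monomial of degree $n$ such that \[ f(x^{2})=\kappa\cdot x^{n}f(x)\qquad(x\in\mathbb{F}). \] Then: (i) if $\kappa\notin\{2^{k}\mid k=0,1,\ldots,n\}$, then $f$ is identically zero; (ii) if $\kappa=1$, then $f(x)=f(1)\cdot x^{n}$ for all $x\in\mathbb{F}$; (iii) if $\kappa=2$, then there exist a derivation $a\colon\mathbb{F}\to\mathbb{K}$ of order $2n-1$ and constants $\lambda_{n,1},\ldots,\lambda_{n,n}\in\mathbb{K}$ such that \[ f(x)=\sum_{j=1}^{n}\lambda_{n,j}\,x^{n-j}a(x^{j})\qquad(x\in\mathbb{F}); \] (iv) if $\kappa=2^{n}$, then there exists a symmetric $n$-additive mapping $A_{n}\colon\mathbb{F}^{n}\to\mathbb{K}$ such that \[ \sum_{\sigma\in\mathscr{S}_{n+1}}\Big\{A_{n}(x_{\sigma(1)}x_{\sigma(2)},x_{\sigma(3)},\ldots,x_{\sigma(n+1)})-x_{\sigma(1)}A_{n}(x_{\sigma(2)},x_{\sigma(3)},\ldots,x_{\sigma(n+1)})-x_{\sigma(2)}A_{n}(x_{\sigma(1)},x_{\sigma(3)},\ldots,x_{\sigma(n+1)})\Big\}=0 \] for all $x_{1},\ldots,x_{n+1}\in\mathbb{F}$, and $f(x)=A_{n}(x,\ldots,x)$ for all $x\in\mathbb{F}$.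
   Context: A map $A\colon\mathbb{F}^{n}\to\mathbb{K}$ is $n$-additive if it is additive in each variable; its trace (diagonalization) is $x\mapsto A(x,\ldots,x)$. A generalized monomial of degree $n$ from $\mathbb{F}$ to $\mathbb{K}$ is a function of the form $f(x)=A(x,\ldots,x)$ where $A\colon\mathbb{F}^{n}\to\mathbb{K}$ is symmetric and $n$-additive. $\mathscr{S}_{n+1}$ denotes the symmetric group on $\{1,\ldots,n+1\}$. Derivations of higher order are defined recursively: the identically zero map is the only derivation of order $0$; for $m\geq1$, an additive map $d\colon\mathbb{F}\to\mathbb{K}$ is a derivation of order $m$ if there exists $B\colon\mathbb{F}\times\mathbb{F}\to\mathbb{K}$ which is a derivation of order $m-1$ in each variable and $d(xy)-xd(y)-d(x)y=B(x,y)$ for all $x,y\in\mathbb{F}$. -}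

module Defs where

open import Level using (Level; _⊔_)
open import Data.Nat as ℕ using (ℕ; zero; suc)
open import Data.Fin as Fin using (Fin; zero; suc)
open import Data.Fin.Permutation using (Permutation′; _⟨$⟩ʳ_)
import Data.Bool
open import Data.Bool using (Bool; true; false; _∨_; not)
open import Data.List using (List; []; _∷_; map; concatMap; allFin; filterᵇ; foldr)
open import Data.Product using (Σ; _×_; _,_; ∃)
open import Relation.Nullary using (¬_; ⌊_⌋)
open import Algebra.Bundles using (CommutativeRing)
open import Relation.Binary.PropositionalEquality using (_≡_)

record IsField {c ℓ} (R : CommutativeRing c ℓ) : Set (c ⊔ ℓ) where
  open CommutativeRing R
  field
    1≉0     : ¬ (1# ≈ 0#)
    inverse : ∀ x → ¬ (x ≈ 0#) → Σ Carrier (λ y → x * y ≈ 1#)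

module _ {c ℓ} (R : CommutativeRing c ℓ) where
  open CommutativeRing R

  natC : ℕ → Carrier
  natC zero    = 0#
  natC (suc k) = 1# + natC k

  pow : Carrier → ℕ → Carrier
  pow x zero    = 1#
  pow x (suc k) = x * pow x k

  CharZero : Set ℓ
  CharZero = ∀ k → ¬ (natC (suc k) ≈ 0#)

  sum1to : ℕ → (ℕ → Carrier) → Carrier
  sum1to zero    g = 0#
  sum1to (suc n) g = sum1to n g + g (suc n)

  sumList : ∀ {a} {A : Set a} → List A → (A → Carrier) → Carrier
  sumList xs g = foldr (λ x s → g x + s) 0# xs

-- Field extension F ⊆ K, given by an (injective) unital ring homomorphism.

record IsEmbedding {c₁ ℓ₁ c₂ ℓ₂} (F : CommutativeRing c₁ ℓ₁) (K : CommutativeRing c₂ ℓ₂)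
       (ι : CommutativeRing.Carrier F → CommutativeRing.Carrier K) : Set (c₁ ⊔ ℓ₁ ⊔ ℓ₂) where
  private
    module F = CommutativeRing F
    module K = CommutativeRing K
  field
    cong  : ∀ {x y} → x F.≈ y → ι x K.≈ ι y
    inj   : ∀ {x y} → ι x K.≈ ι y → x F.≈ y
    +-hom : ∀ x y → ι (x F.+ y) K.≈ ι x K.+ ι y
    *-hom : ∀ x y → ι (x F.* y) K.≈ ι x K.* ι y
    1-hom : ι F.1# K.≈ K.1#

module _ {c₁ ℓ₁ c₂ ℓ₂} (F : CommutativeRing c₁ ℓ₁) (K : CommutativeRing c₂ ℓ₂) where
  private
    module F = CommutativeRing F
    module K = CommutativeRing K

  update : ∀ {n} → (Fin n → F.Carrier) → Fin n → F.Carrier → (Fin n → F.Carrier)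
  update xs i v j with ⌊ j Fin.≟ i ⌋
  ... | true  = v
  ... | false = xs j

  CongMap : ∀ {n} → ((Fin n → F.Carrier) → K.Carrier) → Set (c₁ ⊔ ℓ₁ ⊔ ℓ₂)
  CongMap A = ∀ xs ys → (∀ i → xs i F.≈ ys i) → A xs K.≈ A ys

  CongFun : (F.Carrier → K.Carrier) → Set (c₁ ⊔ ℓ₁ ⊔ ℓ₂)
  CongFun d = ∀ {x y} → x F.≈ y → d x K.≈ d y

  MultiAdditive : ∀ {n} → ((Fin n → F.Carrier) → K.Carrier) → Set (c₁ ⊔ ℓ₂)
  MultiAdditive A = ∀ xs i y z →
    A (update xs i (y F.+ z)) K.≈ A (update xs i y) K.+ A (update xs i z)

  Symmetric : ∀ {n} → ((Fin n → F.Carrier) → K.Carrier) → Set (c₁ ⊔ ℓ₂)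
  Symmetric {n} A = ∀ (π : Permutation′ n) xs → A (λ i → xs (π ⟨$⟩ʳ i)) K.≈ A xs

  SymMultiAdditive : ∀ n → ((Fin n → F.Carrier) → K.Carrier) → Set (c₁ ⊔ ℓ₁ ⊔ ℓ₂)
  SymMultiAdditive n A = CongMap A × MultiAdditive A × Symmetric A

  GenMonomial : ℕ → (F.Carrier → K.Carrier) → Set (c₁ ⊔ ℓ₁ ⊔ c₂ ⊔ ℓ₂)
  GenMonomial n f = ∃ λ (A : (Fin n → F.Carrier) → K.Carrier) →
    SymMultiAdditive n A × (∀ x → f x K.≈ A (λ _ → x))

  Additive : (F.Carrier → K.Carrier) → Set (c₁ ⊔ ℓ₂)
  Additive d = ∀ x y → d (x F.+ y) K.≈ d x K.+ d y

  IsDerivation : (ι : F.Carrier → K.Carrier) → ℕ → (F.Carrier → K.Carrier) → Set (c₁ ⊔ ℓ₁ ⊔ c₂ ⊔ ℓ₂)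
  IsDerivation ι zero    d = Level.Lift (c₁ ⊔ ℓ₁ ⊔ c₂) (∀ x → d x K.≈ K.0#)
  IsDerivation ι (suc m) d =
    CongFun d × Additive d ×
    ∃ λ (B : F.Carrier → F.Carrier → K.Carrier) →
      (∀ y → IsDerivation ι m (λ x → B x y)) ×
      (∀ x → IsDerivation ι m (λ y → B x y)) ×
      (∀ x y → d (x F.* y) K.- ι x K.* d y K.- d x K.* ι y K.≈ B x y)

-- The symmetric group S_k, enumerated as the list of all injective maps
-- Fin k → Fin k (each permutation occurs exactly once).

allFuns : (m k : ℕ) → List (Fin m → Fin k)
allFuns zero    k = (λ ()) ∷ []
allFuns (suc m) k =
  concatMap (λ i → map (λ g → λ { zero → i ; (suc j) → g j }) (allFuns m k)) (allFin k)

allᵇ : ∀ {a} {A : Set a} → (A → Bool) → List A → Bool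
allᵇ p []       = true
allᵇ p (x ∷ xs) = p x Data.Bool.∧ allᵇ p xs

isInjectiveᵇ : ∀ {m k} → (Fin m → Fin k) → Bool
isInjectiveᵇ {m} s =
  allᵇ (λ i → allᵇ (λ j → ⌊ i Fin.≟ j ⌋ ∨ not ⌊ s i Fin.≟ s j ⌋) (allFin m)) (allFin m)

Sym : (k : ℕ) → List (Fin k → Fin k)
Sym k = filterᵇ isInjectiveᵇ (allFuns k k)

module _ {c ℓ} (F : CommutativeRing c ℓ) where
  open CommutativeRing F using (Carrier; _*_)

  mulFirstTwo : ∀ {m} → (Fin (suc (suc m)) → Carrier) → Fin (suc m) → Carrier
  mulFirstTwo y zero    = y zero * y (suc zero)
  mulFirstTwo y (suc i) = y (suc (suc i))

  dropFirst : ∀ {m} → (Fin (suc (suc m)) → Carrier) → Fin (suc m) → Carrier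
  dropFirst y i = y (suc i)

  dropSecond : ∀ {m} → (Fin (suc (suc m)) → Carrier) → Fin (suc m) → Carrier
  dropSecond y zero    = y zero
  dropSecond y (suc i) = y (suc (suc i))

{-# OPTIONS --safe #-}

-- Replace x by x + t for natural numbers t and compare coefficients of powers of t.  Writing
-- f (x + t) = Σ t ^ (n - j) fⱼ(x), the functional equation forces 2 ^ k fₖ = κ fₖ as soon as fⱼ = 0 for
-- all j < k, so that fₖ = 0 unless κ = 2 ^ k.  This settles (i), and (ii) after subtracting f(1) xⁿ.
-- For κ = 2ⁿ it gives f (x + t) = f x, and the next coefficient is A (x², x, …, x) = 2 x A (x, …, x), which
-- polarises to (iv).  For κ = 2 put a = f₁ and (ad x d)(y) = d (x y) - x d (y), and let g be xⁿ times the
-- truncation at degree n of a (log (1 + ad x / x)).  Since ad (x²) = (ad x)² + 2 x (ad x), the identity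
-- log ((1 + s)²) = 2 log (1 + s) shows that g solves the equation up to terms of low degree in t, whence f = g;
-- the leading one of these terms then has to vanish, that is (ad x) ^ (n + 1) a (1) = 0, and a is a
-- derivation of order n, hence of order 2 n - 1.
module Submission where

open import Defs
open import Level using (Level; _⊔_; lift)
open import Data.Nat as ℕ using (ℕ; zero; suc; _≤_; _<_; _∸_; z≤n; s≤s)
import Data.Nat.Properties as ℕₚ
open import Data.Nat.Solver using (module +-*-Solver)
open import Data.Integer as ℤ using (ℤ; +_; -[1+_])
import Data.Integer.Properties as ℤₚ
open import Data.Sign as Sign using (Sign)
open import Data.Bool using (Bool; true; false; _∧_; _∨_; not; if_then_else_)
open import Data.Maybe using (Maybe; just; nothing)
open import Data.Empty using (⊥-elim)
open import Data.Sum using (_⊎_; inj₁; inj₂)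
open import Data.Product using (_×_; ∃; _,_; proj₁; proj₂)
open import Data.Fin as Fin using (Fin; zero; suc; punchOut)
import Data.Fin.Properties as Finₚ
open import Data.Fin.Permutation as Perm using (Permutation′; _⟨$⟩ʳ_)
open import Data.List using (List; []; _∷_; map; concatMap; allFin; filterᵇ; _++_)
open import Data.List.Membership.Propositional using (_∈_)
open import Data.List.Membership.Propositional.Properties using (∈-allFin)
open import Data.List.Relation.Unary.Any using (here; there)
open import Data.Vec using (Vec; []; _∷_; replicate; lookup; tabulate; _[_]≔_)
import Data.Vec.Properties as Vecₚ
open import Function using (_∘_)
open import Function.Definitions using (Injective)
open import Relation.Nullary using (¬_; yes; no; ⌊_⌋; contradiction)
open import Relation.Binary.PropositionalEquality as ≡ using (_≡_)
open import Algebra.Bundles using (CommutativeRing)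
open import Algebra.Solver.Ring.AlmostCommutativeRing using (fromCommutativeRing; _-Raw-AlmostCommutative⟶_)
import Algebra.Solver.Ring
import Algebra.Properties.Ring
import Relation.Binary.Reasoning.Setoid

-- The logarithm has a tensor origin. Regard an additive d as a K-linear functional on K ⊗ F. Then
-- `ad x` is multiplication by 1 ⊗ x - ι x ⊗ 1, and the candidate for κ = 2 is the n-th power of ι x
-- times the value of a at the logarithm of (1 ⊗ x) / (ι x ⊗ 1), which doubles when x is squared.
-- The obstacle is that the series must be truncated before anything is known to be nilpotent: the
-- vanishing that would make the truncation exact is part of what has to be shown. Hence the
-- comparison of coefficients must tolerate an error. It does, because it takes place in t-degree at
-- least n, whereas ad (x + t) = ad x: every error term contains more than n of its 2 n factors as
-- `ad x`, which leaves at most n - 1 factors ι x to carry t. Polynomials in t are known only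
-- through their values at natural numbers, and only a degree bound and a top coefficient are
-- recorded for each; characteristic zero makes that coefficient unique. Where the second
-- coefficient matters, as in (iv), the leading term is subtracted beforehand.

-- Integer multiples in a commutative ring and a ring solver

module RingTools {c ℓ} (R : CommutativeRing c ℓ) where
  open CommutativeRing R
  open Algebra.Properties.Ring ring using (-‿+-comm; -0#≈0#; -‿distribˡ-*; -‿distribʳ-*; -‿involutive)
  open Relation.Binary.Reasoning.Setoid setoid

  nat : ℕ → Carrier
  nat = natC R

  nat-+ : ∀ m n → nat (m ℕ.+ n) ≈ nat m + nat n
  nat-+ zero    n = sym (+-identityˡ _)
  nat-+ (suc m) n = trans (+-congˡ (nat-+ m n)) (sym (+-assoc _ _ _))

  nat-* : ∀ m n → nat (m ℕ.* n) ≈ nat m * nat n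
  nat-* zero    n = sym (zeroˡ _)
  nat-* (suc m) n = begin
    nat (n ℕ.+ m ℕ.* n)       ≈⟨ nat-+ n _ ⟩
    nat n + nat (m ℕ.* n)     ≈⟨ +-cong (sym (*-identityˡ _)) (nat-* m n) ⟩
    1# * nat n + nat m * nat n ≈⟨ distribʳ _ _ _ ⟨
    (1# + nat m) * nat n      ∎

  private
    int : ℤ → Carrier
    int (+ n)    = nat n
    int -[1+ n ] = - nat (suc n)

    1+x-[1+y] : ∀ x y → (1# + x) - (1# + y) ≈ x - y
    1+x-[1+y] x y = begin
      (1# + x) + - (1# + y)     ≈⟨ +-cong (+-comm _ _) (sym (-‿+-comm _ _)) ⟩
      (x + 1#) + (- 1# + - y)   ≈⟨ +-assoc _ _ _ ⟩
      x + (1# + (- 1# + - y))   ≈⟨ +-congˡ (+-assoc _ _ _) ⟨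
      x + ((1# + - 1#) + - y)   ≈⟨ +-congˡ (+-congʳ (-‿inverseʳ _)) ⟩
      x + (0# + - y)            ≈⟨ +-congˡ (+-identityˡ _) ⟩
      x + - y                   ∎

    int-⊖ : ∀ m n → int (m ℤ.⊖ n) ≈ nat m - nat n
    int-⊖ zero    zero    = sym (-‿inverseʳ 0#)
    int-⊖ zero    (suc n) = sym (+-identityˡ _)
    int-⊖ (suc m) zero    = sym (trans (+-congˡ -0#≈0#) (+-identityʳ _))
    int-⊖ (suc m) (suc n) = begin
      int (suc m ℤ.⊖ suc n)      ≡⟨ ≡.cong int (ℤₚ.[1+m]⊖[1+n]≡m⊖n m n) ⟩
      int (m ℤ.⊖ n)              ≈⟨ int-⊖ m n ⟩
      nat m - nat n              ≈⟨ 1+x-[1+y] _ _ ⟨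
      nat (suc m) - nat (suc n)  ∎

    int-+ : ∀ i j → int (i ℤ.+ j) ≈ int i + int j
    int-+ (+ m)    (+ n)    = nat-+ m n
    int-+ (+ m)    -[1+ n ] = int-⊖ m (suc n)
    int-+ -[1+ m ] (+ n)    = trans (int-⊖ n (suc m)) (+-comm _ _)
    int-+ -[1+ m ] -[1+ n ] = begin
      - nat (suc (suc (m ℕ.+ n)))      ≡⟨ ≡.cong (λ k → - nat (suc k)) (ℕₚ.+-suc m n) ⟨
      - nat (suc m ℕ.+ suc n)          ≈⟨ -‿cong (nat-+ (suc m) (suc n)) ⟩
      - (nat (suc m) + nat (suc n))    ≈⟨ -‿+-comm _ _ ⟨
      - nat (suc m) + - nat (suc n)    ∎

    int-◃ : ∀ n → int (Sign.- ℤ.◃ n) ≈ - nat n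
    int-◃ zero    = sym -0#≈0#
    int-◃ (suc n) = refl

    int-* : ∀ i j → int (i ℤ.* j) ≈ int i * int j
    int-* (+ m) (+ n) = begin
      int (Sign.+ ℤ.◃ (m ℕ.* n)) ≡⟨ ≡.cong int (ℤₚ.+◃n≡+n (m ℕ.* n)) ⟩
      nat (m ℕ.* n)              ≈⟨ nat-* m n ⟩
      nat m * nat n              ∎
    int-* (+ m) -[1+ n ] = begin
      int (Sign.- ℤ.◃ (m ℕ.* suc n)) ≈⟨ int-◃ (m ℕ.* suc n) ⟩
      - nat (m ℕ.* suc n)            ≈⟨ -‿cong (nat-* m (suc n)) ⟩
      - (nat m * nat (suc n))        ≈⟨ -‿distribʳ-* _ _ ⟩
      nat m * - nat (suc n)          ∎
    int-* -[1+ m ] (+ n) = begin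
      int (Sign.- ℤ.◃ (suc m ℕ.* n)) ≈⟨ int-◃ (suc m ℕ.* n) ⟩
      - nat (suc m ℕ.* n)            ≈⟨ -‿cong (nat-* (suc m) n) ⟩
      - (nat (suc m) * nat n)        ≈⟨ -‿distribˡ-* _ _ ⟩
      - nat (suc m) * nat n          ∎
    int-* -[1+ m ] -[1+ n ] = begin
      nat (suc m ℕ.* suc n)              ≈⟨ nat-* (suc m) (suc n) ⟩
      nat (suc m) * nat (suc n)          ≈⟨ -‿involutive _ ⟨
      - - (nat (suc m) * nat (suc n))    ≈⟨ -‿cong (-‿distribʳ-* _ _) ⟩
      - (nat (suc m) * - nat (suc n))    ≈⟨ -‿distribˡ-* _ _ ⟩
      - nat (suc m) * - nat (suc n)      ∎

    int-neg : ∀ i → int (ℤ.- i) ≈ - int i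
    int-neg (+ zero)    = sym -0#≈0#
    int-neg (+ (suc n)) = refl
    int-neg -[1+ n ]    = sym (-‿involutive _)

    -- Coefficients are taken in ℤ because the solver has to compare numerals in order to cancel
    -- them, and equality in R itself is not assumed decidable.
    ℤ⟶R : CommutativeRing.rawRing ℤₚ.+-*-commutativeRing -Raw-AlmostCommutative⟶ fromCommutativeRing R
    ℤ⟶R = record
      { ⟦_⟧    = int
      ; +-homo = int-+
      ; *-homo = int-*
      ; -‿homo = int-neg
      ; 0-homo = refl
      ; 1-homo = +-identityʳ 1#
      }

    int-≟ : ∀ i j → Maybe (int i ≈ int j)
    int-≟ i j with i ℤ.≟ j
    ... | yes ≡.refl = just refl
    ... | no  _      = nothing

  -- The constant con (+ n) of this solver denotes natC R n.
  module Solver = Algebra.Solver.Ring _ (fromCommutativeRing R) ℤ⟶R int-≟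

  open Solver using (solve; _:+_; _:*_; _:-_; :-_; con; _:=_)

  pow-cong : ∀ {x y} n → x ≈ y → pow R x n ≈ pow R y n
  pow-cong zero    x≈y = refl
  pow-cong (suc n) x≈y = *-cong x≈y (pow-cong n x≈y)

  pow-* : ∀ x y n → pow R (x * y) n ≈ pow R x n * pow R y n
  pow-* x y zero    = sym (*-identityˡ _)
  pow-* x y (suc n) = trans (*-congˡ (pow-* x y n))
    (solve 4 (λ x y a b → (x :* y) :* (a :* b) := (x :* a) :* (y :* b)) refl x y (pow R x n) (pow R y n))

  x-x≈0 : ∀ {x y} → x ≈ y → x - y ≈ 0#
  x-x≈0 {y = y} e = trans (+-congʳ e) (-‿inverseʳ y)

  x-y≈0⇒x≈y : ∀ {x y} → x - y ≈ 0# → x ≈ y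
  x-y≈0⇒x≈y {x} {y} e = trans (solve 2 (λ x y → x := (x :- y) :+ y) refl x y) (trans (+-congʳ e) (+-identityˡ y))

  x≈0⇒y*x≈0 : ∀ {x} y → x ≈ 0# → y * x ≈ 0#
  x≈0⇒y*x≈0 y e = trans (*-congˡ e) (zeroʳ y)

  x≈0⇒x*y≈0 : ∀ {x} y → x ≈ 0# → x * y ≈ 0#
  x≈0⇒x*y≈0 y e = trans (*-congʳ e) (zeroˡ y)

  x≈0∧y≈0⇒x+y≈0 : ∀ {x y} → x ≈ 0# → y ≈ 0# → x + y ≈ 0#
  x≈0∧y≈0⇒x+y≈0 e e′ = trans (+-cong e e′) (+-identityˡ 0#)

  x+x≈x⇒x≈0 : ∀ {x} → x ≈ x + x → x ≈ 0#
  x+x≈x⇒x≈0 {x} e = begin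
    x           ≈⟨ solve 1 (λ x → x := (x :+ x) :- x) refl x ⟩
    (x + x) - x ≈⟨ x-x≈0 (sym e) ⟩
    0#          ∎

-- Polynomial functions of a natural variable and their top coefficients

module FieldTools {c ℓ} (K : CommutativeRing c ℓ) (field-K : IsField K) (char-K : CharZero K) where
  open CommutativeRing K
  open IsField field-K
  open RingTools K
  open Solver using (solve; _:+_; _:*_; _:-_; :-_; con; _:=_)
  open Relation.Binary.Reasoning.Setoid setoid

  two : Carrier
  two = nat 2

  *-cancel-0 : ∀ {x y} → ¬ (x ≈ 0#) → x * y ≈ 0# → y ≈ 0#
  *-cancel-0 {x} {y} x≉0 xy≈0 with inverse x x≉0
  ... | x⁻¹ , xx⁻¹≈1 = begin
    y              ≈⟨ *-identityˡ y ⟨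
    1# * y         ≈⟨ *-congʳ xx⁻¹≈1 ⟨
    x * x⁻¹ * y    ≈⟨ solve 3 (λ x i y → x :* i :* y := i :* (x :* y)) refl x x⁻¹ y ⟩
    x⁻¹ * (x * y)  ≈⟨ x≈0⇒y*x≈0 x⁻¹ xy≈0 ⟩
    0#             ∎

  *-cancelˡ : ∀ {x y z} → ¬ (x ≈ 0#) → x * y ≈ x * z → y ≈ z
  *-cancelˡ {x} {y} {z} x≉0 e = x-y≈0⇒x≈y (*-cancel-0 x≉0
    (trans (solve 3 (λ x y z → x :* (y :- z) := x :* y :- x :* z) refl x y z) (x-x≈0 e)))

  two^-nat : ∀ k → pow K two k ≈ nat (2 ℕ.^ k)
  two^-nat zero    = sym (+-identityʳ 1#)
  two^-nat (suc k) = trans (*-congˡ (two^-nat k)) (sym (nat-* 2 (2 ℕ.^ k)))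

  nat-injective-< : ∀ {m n} → m < n → ¬ (nat m ≈ nat n)
  nat-injective-< {m} {n} m<n e with ℕₚ.m≤n⇒∃[o]m+o≡n m<n
  ... | o , ≡.refl = char-K o (begin
    nat (suc o)                       ≈⟨ solve 2 (λ a b → b := (a :+ b) :- a) refl (nat m) (nat (suc o)) ⟩
    (nat m + nat (suc o)) - nat m     ≈⟨ x-x≈0 (trans (sym (nat-+ m (suc o))) (trans (reflexive (≡.cong nat (ℕₚ.+-suc m o))) (sym e))) ⟩
    0#                                ∎)

  two^-injective-< : ∀ {i j} → i < j → ¬ (pow K two i ≈ pow K two j)
  two^-injective-< {i} {j} i<j e = nat-injective-< (ℕₚ.^-monoʳ-< 2 (s≤s (s≤s z≤n)) i<j)
    (trans (sym (two^-nat i)) (trans e (two^-nat j)))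

  two^≉0 : ∀ k → ¬ (pow K two k ≈ 0#)
  two^≉0 zero    e = 1≉0 e
  two^≉0 (suc k) e = two^≉0 k (*-cancel-0 (char-K 1) e)

  -- Top d a φ: the sequence φ is a polynomial function of degree at most d whose coefficient at t ^ d is a.
  data Top : ℕ → Carrier → (ℕ → Carrier) → Set (c ⊔ ℓ) where
    constant : ∀ {a φ} → (∀ t → φ t ≈ a) → Top 0 a φ
    horner   : ∀ {d a φ ψ} → Top d a ψ → (a₀ : Carrier) → (∀ t → φ t ≈ a₀ + nat t * ψ t) → Top (suc d) a φ

  top-cong : ∀ {d a b φ ψ} → a ≈ b → (∀ t → φ t ≈ ψ t) → Top d a φ → Top d b ψ
  top-cong a≈b φ≈ψ (constant p)    = constant (λ t → trans (sym (φ≈ψ t)) (trans (p t) a≈b))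
  top-cong a≈b φ≈ψ (horner p a₀ e) =
    horner (top-cong a≈b (λ _ → refl) p) a₀ (λ t → trans (sym (φ≈ψ t)) (e t))

  top-degree : ∀ {d e a φ} → d ≡ e → Top d a φ → Top e a φ
  top-degree ≡.refl p = p

  top-+ : ∀ {d a b φ ψ} → Top d a φ → Top d b ψ → Top d (a + b) (λ t → φ t + ψ t)
  top-+ (constant p) (constant q) = constant (λ t → +-cong (p t) (q t))
  top-+ (horner {ψ = χ} p a₀ e) (horner {ψ = χ′} p′ a₀′ e′) =
    horner (top-+ p p′) (a₀ + a₀′) (λ t → trans (+-cong (e t) (e′ t))
      (solve 5 (λ a b n x y → (a :+ n :* x) :+ (b :+ n :* y) := (a :+ b) :+ n :* (x :+ y))
        refl a₀ a₀′ (nat t) (χ t) (χ′ t)))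

  top-scale : ∀ {d a φ} k → Top d a φ → Top d (k * a) (λ t → k * φ t)
  top-scale k (constant p) = constant (λ t → *-congˡ (p t))
  top-scale k (horner {ψ = χ} p a₀ e) =
    horner (top-scale k p) (k * a₀) (λ t → trans (*-congˡ (e t))
      (solve 4 (λ k a n x → k :* (a :+ n :* x) := k :* a :+ n :* (k :* x)) refl k a₀ (nat t) (χ t)))

  top-neg : ∀ {d a φ} → Top d a φ → Top d (- a) (λ t → - φ t)
  top-neg (constant p) = constant (λ t → -‿cong (p t))
  top-neg (horner {ψ = χ} p a₀ e) =
    horner (top-neg p) (- a₀) (λ t → trans (-‿cong (e t))
      (solve 3 (λ a n x → :- (a :+ n :* x) := :- a :+ n :* (:- x)) refl a₀ (nat t) (χ t)))

  top-const : ∀ a → Top 0 a (λ _ → a)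
  top-const a = constant (λ _ → refl)

  top-weaken : ∀ {d a φ} → Top d a φ → Top (suc d) 0# φ
  top-weaken {a = a} (constant p) = horner (top-const 0#) a
    (λ t → trans (p t) (trans (sym (+-identityʳ a)) (+-congˡ (sym (zeroʳ _)))))
  top-weaken (horner p a₀ e) = horner (top-weaken p) a₀ e

  top-weaken-+ : ∀ {d φ} j → Top d 0# φ → Top (j ℕ.+ d) 0# φ
  top-weaken-+ zero    p = p
  top-weaken-+ (suc j) p = top-weaken (top-weaken-+ j p)

  top-weaken-< : ∀ {d e a φ} → d < e → Top d a φ → Top e 0# φ
  top-weaken-< {d} d<e p with ℕₚ.m≤n⇒∃[o]m+o≡n d<e
  ... | o , ≡.refl = top-degree (ℕₚ.+-comm o (suc d)) (top-weaken-+ o (top-weaken p))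

  top-zero : ∀ d {φ} → (∀ t → φ t ≈ 0#) → Top d 0# φ
  top-zero zero    p = constant p
  top-zero (suc d) p = top-weaken (top-zero d p)

  top-shift : ∀ {d a φ} → Top d a φ → Top (suc d) a (λ t → nat t * φ t)
  top-shift p = horner p 0# (λ t → sym (+-identityˡ _))

  top-nat : Top 1 1# nat
  top-nat = top-cong refl (λ t → *-identityʳ _) (top-shift (top-const 1#))

  top-* : ∀ {d e a b φ ψ} → Top d a φ → Top e b ψ → Top (d ℕ.+ e) (a * b) (λ t → φ t * ψ t)
  top-* {a = a} (constant p) q = top-cong refl (λ t → *-congʳ (sym (p t))) (top-scale a q)
  top-* {suc d} {e} {φ = φ} {ψ} (horner {ψ = χ} p a₀ r) q =
    top-cong (+-identityˡ _)
      (λ t → trans (solve 4 (λ a y n x → a :* y :+ n :* (x :* y) := (a :+ n :* x) :* y) refl a₀ (ψ t) (nat t) (χ t))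
                   (*-congʳ (sym (r t))))
      (top-+ (top-weaken-< (s≤s (ℕₚ.m≤n+m e d)) (top-scale a₀ q)) (top-shift (top-* p q)))

  top-pow : ∀ {d φ} n → Top d 1# φ → Top (n ℕ.* d) 1# (λ t → pow K (φ t) n)
  top-pow zero    p = top-const 1#
  top-pow (suc n) p = top-cong (*-identityˡ 1#) (λ _ → refl) (top-* p (top-pow n p))

  -- The source of the powers of two in the theorem: it is applied along the line x² + 2 t x.
  top-double : ∀ {d a φ} → Top d a φ → Top d (pow K two d * a) (λ t → φ (2 ℕ.* t))
  top-double (constant p) = constant (λ t → trans (p _) (sym (*-identityˡ _)))
  top-double (horner {ψ = χ} p a₀ e) =
    horner (top-cong (sym (*-assoc _ _ _)) (λ _ → refl) (top-scale two (top-double p))) a₀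
      (λ t → trans (e (2 ℕ.* t)) (+-congˡ (trans (*-congʳ (nat-* 2 t))
        (solve 3 (λ w n x → (w :* n) :* x := n :* (w :* x)) refl two (nat t) (χ (2 ℕ.* t))))))

  top-suc : ∀ {d a φ} → Top d a φ → Top d a (λ t → φ (suc t))
  top-suc (constant p) = constant (λ t → p (suc t))
  top-suc (horner {d} {ψ = χ} p a₀ e) =
    top-cong (trans (+-congʳ (+-identityˡ _)) (+-identityˡ _))
      (λ t → trans
        (solve 3 (λ a n x → (a :+ x) :+ n :* x := a :+ (con (+ 1) :+ n) :* x) refl a₀ (nat t) (χ (suc t)))
        -- The solver's `con (+ 1)` stands for `1# + 0#`, so it has to be matched with the `1#` in
        -- `nat (suc t)`; the same correction recurs below.
        (trans (+-congˡ (*-congʳ (+-congʳ (+-identityʳ 1#)))) (sym (e (suc t)))))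
      (top-+ (top-+ (top-weaken-< (s≤s z≤n) (top-const a₀)) (top-weaken (top-suc p))) (top-shift (top-suc p)))

  -- The finite difference replaces the derivative. For φ t = a₀ + t χ t it equals χ (t + 1) + t (χ
  -- (t + 1) - χ t), so the factor d + 1 builds up as 1 + d.
  top-difference : ∀ {d a φ} → Top (suc d) a φ → Top d (nat (suc d) * a) (λ t → φ (suc t) - φ t)
  top-difference {a = a} {φ} (horner {ψ = χ} p a₀ e) = go p
    where
    Δφ : ∀ t → χ (suc t) + nat t * (χ (suc t) - χ t) ≈ φ (suc t) - φ t
    Δφ t = trans
      (solve 4 (λ a n x y → x :+ n :* (x :- y) := (a :+ (con (+ 1) :+ n) :* x) :- (a :+ n :* y)) refl a₀ (nat t) (χ (suc t)) (χ t))
      (+-cong (trans (+-congˡ (*-congʳ (+-congʳ (+-identityʳ 1#)))) (sym (e (suc t)))) (-‿cong (sym (e t))))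

    go : ∀ {d} → Top d a χ → Top d (nat (suc d) * a) (λ t → φ (suc t) - φ t)
    go (constant q) = constant (λ t → trans (sym (Δφ t)) (trans
      (+-cong (q _) (*-congˡ (x-x≈0 (trans (q (suc t)) (sym (q t))))))
      (solve 2 (λ a n → a :+ n :* con (+ 0) := con (+ 1) :* a) refl a (nat t))))
    go {suc d} q@(horner _ _ _) = top-cong
      (trans (solve 2 (λ a n → a :+ n :* a := (con (+ 1) :+ n) :* a) refl a (nat (suc d)))
             (*-congʳ (+-congʳ (+-identityʳ 1#))))
      Δφ (top-+ (top-suc q) (top-shift (top-difference q)))

  -- Differences bring the degree down to 0 while multiplying the top coefficient by nonzero
  -- integers, which characteristic zero cancels.
  top-vanish : ∀ {d a φ} → Top d a φ → (∀ t → φ t ≈ 0#) → a ≈ 0#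
  top-vanish {zero}  (constant p) z = trans (sym (p 0)) (z 0)
  top-vanish {suc d} p            z =
    *-cancel-0 (char-K d) (top-vanish (top-difference p) (λ t → x-x≈0 (trans (z (suc t)) (sym (z t)))))

  top-unique : ∀ {d a b φ ψ} → Top d a φ → Top d b ψ → (∀ t → φ t ≈ ψ t) → a ≈ b
  top-unique p q e = x-y≈0⇒x≈y (top-vanish (top-+ p (top-neg q)) (λ t → x-x≈0 (e t)))

  -- Homogeneous sums

  -- hev S n w is the sum of S ^ (n - j) * w j over j = 0, …, n.
  hev : Carrier → ℕ → (ℕ → Carrier) → Carrier
  hev S zero    w = w 0
  hev S (suc n) w = S * hev S n w + w (suc n)

  hev-cong : ∀ {S S′} n {w w′} → S ≈ S′ → (∀ j → j ≤ n → w j ≈ w′ j) → hev S n w ≈ hev S′ n w′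
  hev-cong zero    s e = e 0 z≤n
  hev-cong (suc n) s e =
    +-cong (*-cong s (hev-cong n s (λ j j≤n → e j (ℕₚ.m≤n⇒m≤1+n j≤n)))) (e (suc n) ℕₚ.≤-refl)

  hev-congʳ : ∀ {S} n {w w′} → (∀ j → w j ≈ w′ j) → hev S n w ≈ hev S n w′
  hev-congʳ n e = hev-cong n refl (λ j _ → e j)

  hev-+ : ∀ S n w w′ → hev S n (λ j → w j + w′ j) ≈ hev S n w + hev S n w′
  hev-+ S zero    w w′ = refl
  hev-+ S (suc n) w w′ = trans (+-congʳ (*-congˡ (hev-+ S n w w′)))
    (solve 5 (λ s a b c d → s :* (a :+ b) :+ (c :+ d) := (s :* a :+ c) :+ (s :* b :+ d)) refl
      S (hev S n w) (hev S n w′) (w (suc n)) (w′ (suc n)))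

  hev-scale : ∀ S n k w → hev S n (λ j → k * w j) ≈ k * hev S n w
  hev-scale S zero    k w = refl
  hev-scale S (suc n) k w = trans (+-congʳ (*-congˡ (hev-scale S n k w)))
    (solve 4 (λ s k a c → s :* (k :* a) :+ k :* c := k :* (s :* a :+ c)) refl S k (hev S n w) (w (suc n)))

  hev-zero : ∀ S n {w} → (∀ j → j ≤ n → w j ≈ 0#) → hev S n w ≈ 0#
  hev-zero S zero    e = e 0 z≤n
  hev-zero S (suc n) e =
    x≈0∧y≈0⇒x+y≈0 (x≈0⇒y*x≈0 S (hev-zero S n (λ j j≤n → e j (ℕₚ.m≤n⇒m≤1+n j≤n)))) (e (suc n) ℕₚ.≤-refl)

  hev-suc : ∀ S n {w} → w (suc n) ≈ 0# → hev S (suc n) w ≈ S * hev S n w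
  hev-suc S n e = trans (+-congˡ e) (+-identityʳ _)

  hev-head : ∀ S n w → hev S (suc n) w ≈ pow K S (suc n) * w 0 + hev S n (λ j → w (suc j))
  hev-head S zero    w = +-congʳ (*-congʳ (sym (*-identityʳ S)))
  hev-head S (suc n) w = trans (+-congʳ (*-congˡ (hev-head S n w)))
    (solve 5 (λ s p a h c → s :* (p :* a :+ h) :+ c := s :* p :* a :+ (s :* h :+ c)) refl
      S (pow K S (suc n)) (w 0) (hev S n (λ j → w (suc j))) (w (suc (suc n))))

  hev-tail : ∀ S n {w} → w 0 ≈ 0# → hev S (suc n) w ≈ hev S n (λ j → w (suc j))
  hev-tail S n e = trans (hev-head S n _) (trans (+-congʳ (x≈0⇒y*x≈0 _ e)) (+-identityˡ _))

  hev-last : ∀ S n {w} → (∀ j → j < n → w j ≈ 0#) → hev S n w ≈ w n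
  hev-last S zero    e = refl
  hev-last S (suc n) e = trans (+-congʳ (x≈0⇒y*x≈0 S (hev-zero S n (λ j j≤n → e j (s≤s j≤n))))) (+-identityˡ _)

  hev-at-0 : ∀ {S} n w → S ≈ 0# → hev S n w ≈ w n
  hev-at-0 zero    w e = refl
  hev-at-0 (suc n) w e = trans (+-congʳ (x≈0⇒x*y≈0 _ e)) (+-identityˡ _)

  -- Used on g (x²): the first summand becomes 2 xⁿ g (x) and the second is the error of the
  -- truncated logarithm.
  hev-split : ∀ S q n w →
    hev S (q ℕ.+ suc n) w ≈ pow K S (suc q) * hev S n w + hev S q (λ j → w (j ℕ.+ suc n))
  hev-split S zero    n w = +-congʳ (*-congʳ (sym (*-identityʳ S)))
  hev-split S (suc q) n w = trans (+-congʳ (*-congˡ (hev-split S q n w)))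
    (solve 5 (λ s p a h c → s :* (p :* a :+ h) :+ c := s :* p :* a :+ (s :* h :+ c)) refl
      S (pow K S (suc q)) (hev S n w) (hev S q (λ j → w (j ℕ.+ suc n))) (w (suc q ℕ.+ suc n)))

  -- With N = q + k, the term S ^ (N - j) * w j has degree N (ν + 1) - j, which drops by one as j
  -- grows; so the first index k whose term may be nonzero decides the top coefficient. The case ν =
  -- 1 serves for S = t², the case ν = 0 for S = t or S = ι x + t.
  hev-top : ∀ ν k q {S : ℕ → Carrier} {w : ℕ → ℕ → Carrier} (a : ℕ → Carrier) →
    Top (suc ν) 1# S → (∀ j → j < k → ∀ t → w j t ≈ 0#) → (∀ j → Top (j ℕ.* ν) (a j) (w j)) →
    Top (q ℕ.* suc ν ℕ.+ k ℕ.* ν) (a k) (λ t → hev (S t) (q ℕ.+ k) (λ j → w j t))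
  hev-top ν k zero    {S} a topS low topw =
    top-cong refl (λ t → sym (hev-last (S t) k (λ j j<k → low j j<k t))) (topw k)
  hev-top ν k (suc q) {S} {w} a topS low topw =
    top-cong (trans (+-identityʳ _) (*-identityˡ _)) (λ _ → refl)
      (top-+ (top-degree (≡.sym (ℕₚ.+-assoc (suc ν) (q ℕ.* suc ν) (k ℕ.* ν)))
               (top-* topS (hev-top ν k q a topS low topw)))
             -- The newly added last term falls short of the leading degree by q + 1.
             (top-weaken-< degree-< (topw (suc (q ℕ.+ k)))))
    where
    degree-< : suc (q ℕ.+ k) ℕ.* ν < suc q ℕ.* suc ν ℕ.+ k ℕ.* ν
    degree-< = ℕₚ.≤-trans (s≤s (ℕₚ.≤-reflexive (ℕₚ.*-distribʳ-+ ν (suc q) k)))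
      (ℕₚ.+-monoˡ-< (k ℕ.* ν) (ℕₚ.*-monoʳ-< (suc q) (ℕₚ.n<1+n ν)))

-- Self-maps of a finite set

module _ {n : ℕ} where

  -- If i were missed, `punchOut` would squeeze the image injectively into a set with one element
  -- fewer.
  injective⇒surjective : {g : Fin n → Fin n} → Injective _≡_ _≡_ g → ∀ i → ∃ λ j → g j ≡ i
  injective⇒surjective {g} inj i with Finₚ.any? (λ j → g j Fin.≟ i)
  ... | yes p = p
  ... | no ∄j = ⊥-elim (missing i ∄j inj)
    where
    missing : ∀ {n} {g : Fin n → Fin n} i → ¬ (∃ λ j → g j ≡ i) → ¬ Injective _≡_ _≡_ g
    missing {suc n} {g} i ∄j inj = ℕₚ.1+n≰n (Finₚ.injective⇒≤ {f = λ j → punchOut (i≢g j)}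
      (λ {j} {k} e → inj (Finₚ.punchOut-injective (i≢g j) (i≢g k) e)))
      where
      i≢g : ∀ j → ¬ (i ≡ g j)
      i≢g j e = ∄j (j , ≡.sym e)

  -- A section is injective, hence surjective by the previous lemma, hence a two-sided inverse.
  surjective⇒injective : {g : Fin n → Fin n} → (∀ i → ∃ λ j → g j ≡ i) → Injective _≡_ _≡_ g
  surjective⇒injective {g} surj {j} {k} gj≡gk = begin
    j                    ≡⟨ section-retract j ⟨
    section (g j)        ≡⟨ ≡.cong section gj≡gk ⟩
    section (g k)        ≡⟨ section-retract k ⟩
    k                    ∎
    where
    open ≡.≡-Reasoning
    section : Fin n → Fin n
    section = proj₁ ∘ surj
    g-section : ∀ i → g (section i) ≡ i
    g-section = proj₂ ∘ surj
    section-injective : Injective _≡_ _≡_ section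
    section-injective {i} {i′} e = ≡.trans (≡.sym (g-section i)) (≡.trans (≡.cong g e) (g-section i′))
    section-retract : ∀ j → section (g j) ≡ j
    section-retract j with injective⇒surjective section-injective j
    ... | i , ≡.refl = ≡.cong section (g-section i)

∧-true : ∀ {a b} → a ∧ b ≡ true → a ≡ true × b ≡ true
∧-true {true} e = ≡.refl , e

allᵇ⁻ : ∀ {a} {A : Set a} (p : A → Bool) xs → allᵇ p xs ≡ true → ∀ {x} → x ∈ xs → p x ≡ true
allᵇ⁻ p (x ∷ xs) e (here ≡.refl) = proj₁ (∧-true e)
allᵇ⁻ p (x ∷ xs) e (there x∈xs)  = allᵇ⁻ p xs (proj₂ (∧-true {p x} e)) x∈xs

allᵇ⁺ : ∀ {a} {A : Set a} (p : A → Bool) xs → (∀ x → p x ≡ true) → allᵇ p xs ≡ true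
allᵇ⁺ p []       h = ≡.refl
allᵇ⁺ p (x ∷ xs) h rewrite h x = allᵇ⁺ p xs h

isInjectiveᵇ⁻ : ∀ {m k} (s : Fin m → Fin k) → isInjectiveᵇ s ≡ true → Injective _≡_ _≡_ s
isInjectiveᵇ⁻ {m} s e {i} {j} si≡sj
  with allᵇ⁻ _ (allFin m) (allᵇ⁻ _ (allFin m) e (∈-allFin i)) (∈-allFin j)
... | q with i Fin.≟ j | s i Fin.≟ s j
... | yes i≡j | _        = i≡j
... | no  _   | no si≢sj = contradiction si≡sj si≢sj

isInjectiveᵇ⁺ : ∀ {m k} (s : Fin m → Fin k) → Injective _≡_ _≡_ s → isInjectiveᵇ s ≡ true
isInjectiveᵇ⁺ {m} s inj = allᵇ⁺ _ (allFin m) (λ i → allᵇ⁺ _ (allFin m) (λ j → check i j))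
  where
  check : ∀ i j → (⌊ i Fin.≟ j ⌋ ∨ not ⌊ s i Fin.≟ s j ⌋) ≡ true
  check i j with i Fin.≟ j | s i Fin.≟ s j
  ... | yes _   | _         = ≡.refl
  ... | no  i≢j | yes si≡sj = contradiction (inj si≡sj) i≢j
  ... | no  _   | no  _     = ≡.refl

-- Inclusion-exclusion over subsets

module Alternation {c ℓ} (K : CommutativeRing c ℓ) where
  open CommutativeRing K hiding (zero)
  open RingTools K
  open Solver using (solve; _:+_; _:*_; _:-_; :-_; con; _:=_)
  open Relation.Binary.Reasoning.Setoid setoid

  sumList-cong : ∀ {a} {A : Set a} (xs : List A) {g h : A → Carrier} → (∀ x → g x ≈ h x) → sumList K xs g ≈ sumList K xs h
  sumList-cong []       e = refl
  sumList-cong (x ∷ xs) e = +-cong (e x) (sumList-cong xs e)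

  sumList-++ : ∀ {a} {A : Set a} (xs ys : List A) g → sumList K (xs ++ ys) g ≈ sumList K xs g + sumList K ys g
  sumList-++ []       ys g = sym (+-identityˡ _)
  sumList-++ (x ∷ xs) ys g = trans (+-congˡ (sumList-++ xs ys g)) (sym (+-assoc _ _ _))

  sumList-map : ∀ {a b} {A : Set a} {B : Set b} (f : A → B) xs g → sumList K (map f xs) g ≈ sumList K xs (g ∘ f)
  sumList-map f []       g = refl
  sumList-map f (x ∷ xs) g = +-congˡ (sumList-map f xs g)

  sumList-concatMap : ∀ {a b} {A : Set a} {B : Set b} (f : A → List B) xs g →
                      sumList K (concatMap f xs) g ≈ sumList K xs (λ x → sumList K (f x) g)
  sumList-concatMap f []       g = refl
  sumList-concatMap f (x ∷ xs) g =
    trans (sumList-++ (f x) (concatMap f xs) g) (+-congˡ (sumList-concatMap f xs g))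

  sumList-scale : ∀ {a} {A : Set a} k (xs : List A) g → sumList K xs (λ x → k * g x) ≈ k * sumList K xs g
  sumList-scale k []       g = sym (zeroʳ k)
  sumList-scale k (x ∷ xs) g = trans (+-congˡ (sumList-scale k xs g)) (sym (distribˡ _ _ _))

  indicator : Bool → Carrier
  indicator b = if b then 1# else 0#

  sumList-filterᵇ : ∀ {a} {A : Set a} (p : A → Bool) xs g →
                    sumList K (filterᵇ p xs) g ≈ sumList K xs (λ x → indicator (p x) * g x)
  sumList-filterᵇ p []       g = refl
  sumList-filterᵇ p (x ∷ xs) g with p x
  ... | true  = +-cong (sym (*-identityˡ _)) (sumList-filterᵇ p xs g)
  ... | false = trans (sumList-filterᵇ p xs g) (sym (trans (+-congʳ (zeroˡ _)) (+-identityˡ _)))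

  -- A Boolean vector is a subset of N points. This is the sum of Φ over all subsets, with one minus
  -- sign for each point left out, written as an iterated difference.
  alternate : ∀ {N} → (Vec Bool N → Carrier) → Carrier
  alternate {zero}  Φ = Φ []
  alternate {suc N} Φ = alternate (λ c → Φ (true ∷ c)) - alternate (λ c → Φ (false ∷ c))

  alternate-cong : ∀ {N} {Φ Ψ : Vec Bool N → Carrier} → (∀ c → Φ c ≈ Ψ c) → alternate Φ ≈ alternate Ψ
  alternate-cong {zero}  e = e []
  alternate-cong {suc N} e = +-cong (alternate-cong (λ c → e (true ∷ c))) (-‿cong (alternate-cong (λ c → e (false ∷ c))))

  alternate-0 : ∀ {N} {Φ : Vec Bool N → Carrier} → (∀ c → Φ c ≈ 0#) → alternate Φ ≈ 0#
  alternate-0 {zero}  e = e []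
  alternate-0 {suc N} e = x-x≈0 (trans (alternate-0 (λ c → e (true ∷ c))) (sym (alternate-0 (λ c → e (false ∷ c)))))

  alternate-+ : ∀ {N} (Φ Ψ : Vec Bool N → Carrier) → alternate (λ c → Φ c + Ψ c) ≈ alternate Φ + alternate Ψ
  alternate-+ {zero}  Φ Ψ = refl
  alternate-+ {suc N} Φ Ψ = trans (+-cong (alternate-+ {N} _ _) (-‿cong (alternate-+ {N} _ _)))
    (solve 4 (λ a b c d → (a :+ b) :- (c :+ d) := (a :- c) :+ (b :- d)) refl _ _ _ _)

  alternate-scale : ∀ {N} (Φ : Vec Bool N → Carrier) k → alternate (λ c → Φ c * k) ≈ alternate Φ * k
  alternate-scale {zero}  Φ k = refl
  alternate-scale {suc N} Φ k = trans (+-cong (alternate-scale {N} _ k) (-‿cong (alternate-scale {N} _ k)))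
    (solve 3 (λ a b k → a :* k :- b :* k := (a :- b) :* k) refl _ _ k)

  alternate-sumList : ∀ {N a} {A : Set a} (xs : List A) (Φ : A → Vec Bool N → Carrier) →
    alternate (λ c → sumList K xs (λ x → Φ x c)) ≈ sumList K xs (λ x → alternate (Φ x))
  alternate-sumList {N} []   Φ = alternate-0 {N} (λ _ → refl)
  alternate-sumList (x ∷ xs) Φ = trans (alternate-+ (Φ x) _) (+-congˡ (alternate-sumList xs Φ))

  alternate-independent : ∀ {N} (Φ : Vec Bool N → Carrier) i →
    (∀ c → Φ (c [ i ]≔ true) ≈ Φ (c [ i ]≔ false)) → alternate Φ ≈ 0#
  alternate-independent Φ zero    e = x-x≈0 (alternate-cong (λ c → e (true ∷ c)))
  alternate-independent Φ (suc i) e = x-x≈0 (trans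
    (alternate-independent _ i (λ c → e (true ∷ c)))
    (sym (alternate-independent _ i (λ c → e (false ∷ c)))))

  alternate-full : ∀ {N} (Φ : Vec Bool N → Carrier) →
    (∀ c i → lookup c i ≡ false → Φ c ≈ 0#) → alternate Φ ≈ Φ (replicate N true)
  alternate-full {zero}  Φ e = refl
  alternate-full {suc N} Φ e = begin
    alternate (λ c → Φ (true ∷ c)) - alternate (λ c → Φ (false ∷ c))
      ≈⟨ +-cong (alternate-full _ (λ c i → e (true ∷ c) (suc i)))
                (-‿cong (alternate-0 (λ c → e (false ∷ c) zero ≡.refl))) ⟩
    Φ (replicate (suc N) true) - 0#
      ≈⟨ solve 1 (λ a → a :- con (+ 0) := a) refl _ ⟩
    Φ (replicate (suc N) true) ∎

  -- The indicator that `g` takes all its values in the subset `c`. It is a product because the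
  -- multiadditive expansion produces it one factor per argument.
  covers : ∀ {m N} → Vec Bool N → (Fin m → Fin N) → Carrier
  covers {zero}  c g = 1#
  covers {suc m} c g = indicator (lookup c (g zero)) * covers c (g ∘ suc)

  covers-false : ∀ {m N} (c : Vec Bool N) (g : Fin m → Fin N) j → lookup c (g j) ≡ false → covers c g ≈ 0#
  covers-false c g zero    e rewrite e = zeroˡ _
  covers-false c g (suc j) e = x≈0⇒y*x≈0 _ (covers-false c (g ∘ suc) j e)

  covers-true : ∀ {m N} (g : Fin m → Fin N) → covers (replicate N true) g ≈ 1#
  covers-true {zero}  g = refl
  covers-true {suc m} g = trans
    (*-cong (reflexive (≡.cong indicator (Vecₚ.lookup-replicate (g zero) true))) (covers-true (g ∘ suc)))
    (*-identityˡ 1#)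

  covers-missing : ∀ {m N} (c : Vec Bool N) (g : Fin m → Fin N) i b → (∀ j → ¬ (g j ≡ i)) →
                   covers (c [ i ]≔ b) g ≈ covers c g
  covers-missing {zero}  c g i b ∄ = refl
  covers-missing {suc m} c g i b ∄ = *-cong
    (reflexive (≡.cong indicator (Vecₚ.lookup∘update′ (∄ zero) c b)))
    (covers-missing c (g ∘ suc) i b (∄ ∘ suc))

  -- Inclusion–exclusion: summing over all sets of values with signs picks out the bijections.
  alternate-covers : ∀ {N} (g : Fin N → Fin N) → alternate (λ c → covers c g) ≈ indicator (isInjectiveᵇ g)
  alternate-covers {N} g with isInjectiveᵇ g in e
  ... | true = trans
    (alternate-full _ (λ c i ci≡f → let j , gj≡i = injective⇒surjective (isInjectiveᵇ⁻ g e) i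
                                    in covers-false c g j (≡.trans (≡.cong (lookup c) gj≡i) ci≡f)))
    (covers-true g)
  ... | false with Finₚ.all? (λ i → Finₚ.any? (λ j → g j Fin.≟ i))
  ...   | yes surj = contradiction (≡.trans (≡.sym e) (isInjectiveᵇ⁺ g (surjective⇒injective surj))) (λ ())
  ...   | no ¬surj with Finₚ.¬∀⟶∃¬ N _ (λ i → Finₚ.any? (λ j → g j Fin.≟ i)) ¬surj
  ...     | i , ∄j = alternate-independent _ i (λ c → trans
                (covers-missing c g i true (λ j p → ∄j (j , p)))
                (sym (covers-missing c g i false (λ j p → ∄j (j , p)))))

-- Coefficients of the truncated logarithm

module Logarithm {c ℓ} (K : CommutativeRing c ℓ) (field-K : IsField K) (char-K : CharZero K) where
  open CommutativeRing K hiding (zero)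
  open IsField field-K
  open RingTools K
  open Solver using (solve; _:+_; _:*_; _:-_; :-_; con; _:=_)
  open FieldTools K field-K char-K
  open Relation.Binary.Reasoning.Setoid setoid

  -- Multiplication by t on coefficient sequences of power series.
  shift : (ℕ → Carrier) → ℕ → Carrier
  shift w zero    = 0#
  shift w (suc p) = w p

  shift-cong : ∀ {w w′} → (∀ p → w p ≈ w′ p) → ∀ p → shift w p ≈ shift w′ p
  shift-cong e zero    = refl
  shift-cong e (suc p) = e p

  shift-linear : ∀ w k w′ p → shift (λ q → w q + k * w′ q) p ≈ shift w p + k * shift w′ p
  shift-linear w k w′ zero    = sym (trans (+-identityˡ _) (zeroʳ k))
  shift-linear w k w′ (suc p) = refl

  shift-+ : ∀ w w′ p → shift (λ q → w q + w′ q) p ≈ shift w p + shift w′ p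
  shift-+ w w′ zero    = sym (+-identityˡ _)
  shift-+ w w′ (suc p) = refl

  shift-scale : ∀ k w p → shift (λ q → k * w q) p ≈ k * shift w p
  shift-scale k w zero    = sym (zeroʳ k)
  shift-scale k w (suc p) = refl

  shift-zero : ∀ {w} → (∀ p → w p ≈ 0#) → ∀ p → shift w p ≈ 0#
  shift-zero e zero    = refl
  shift-zero e (suc p) = e p

  unit : ℕ → Carrier
  unit zero    = 1#
  unit (suc p) = 0#

  -- b r p is the coefficient of t ^ p in (2 t + t²) ^ r.
  b : ℕ → ℕ → Carrier
  b zero    p = unit p
  b (suc r) p = two * shift (b r) p + shift (shift (b r)) p

  -- 2 t + t² has degree 2 and order 1, so its r-th power lives in degrees r to 2 r; the next lemma
  -- is the lower bound.
  b-> : ∀ r p → r ℕ.* 2 < p → b r p ≈ 0#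
  b-> zero    (suc p)       _             = refl
  b-> (suc r) (suc (suc p)) (s≤s (s≤s h)) =
    x≈0∧y≈0⇒x+y≈0 (x≈0⇒y*x≈0 two (b-> r (suc p) (ℕₚ.m≤n⇒m≤1+n h))) (b-> r p h)

  b-< : ∀ r p → p < r → b r p ≈ 0#
  b-< (suc r) zero          _       = x≈0∧y≈0⇒x+y≈0 (zeroʳ two) refl
  b-< (suc r) (suc zero)    (s≤s h) = x≈0∧y≈0⇒x+y≈0 (x≈0⇒y*x≈0 two (b-< r 0 h)) refl
  b-< (suc r) (suc (suc p)) (s≤s h) =
    x≈0∧y≈0⇒x+y≈0 (x≈0⇒y*x≈0 two (b-< r (suc p) h)) (b-< r p (ℕₚ.<-trans (ℕₚ.n<1+n p) h))

  b-diagonal : ∀ r → b r r ≈ pow K two r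
  b-diagonal zero          = refl
  b-diagonal (suc zero)    = trans (+-identityʳ _) refl
  b-diagonal (suc (suc r)) = trans (+-cong (*-congˡ (b-diagonal (suc r))) (b-< (suc r) r ℕₚ.≤-refl)) (+-identityʳ _)

  -- Multiplying the p-th coefficient by `nat p` is the Euler operator t d/dt, and this is its
  -- product rule for t times w. Unlike d/dt it leaves the indices in place.
  euler-shift : ∀ w p → nat p * shift w p ≈ shift (λ q → nat q * w q) p + shift w p
  euler-shift w zero    = solve 1 (λ z → con (+ 0) :* con (+ 0) := con (+ 0) :+ con (+ 0)) refl 0#
  euler-shift w (suc p) = trans (distribʳ _ _ _) (trans (+-congʳ (*-identityˡ _)) (+-comm _ _))

  euler-shift² : ∀ w p → nat p * shift (shift w) p ≈ shift (shift (λ q → nat q * w q)) p + two * shift (shift w) p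
  euler-shift² w p = begin
    nat p * shift (shift w) p
      ≈⟨ euler-shift (shift w) p ⟩
    shift (λ q → nat q * shift w q) p + shift (shift w) p
      ≈⟨ +-congʳ (trans (shift-cong (euler-shift w) p) (shift-+ _ _ p)) ⟩
    (shift (shift (λ q → nat q * w q)) p + shift (shift w) p) + shift (shift w) p
      ≈⟨ solve 2 (λ a s → (a :+ s) :+ s := a :+ con (+ 2) :* s) refl _ _ ⟩
    shift (shift (λ q → nat q * w q)) p + two * shift (shift w) p ∎

  -- The derivative of (2 t + t²) ^ (r + 1) is 2 (r + 1) (1 + t) (2 t + t²) ^ r.
  euler-b : ∀ r p → nat p * b (suc r) p ≈ two * nat (suc r) * (shift (b r) p + shift (shift (b r)) p)
  euler-b r p = begin
    nat p * (two * shift (b r) p + shift (shift (b r)) p)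
      ≈⟨ solve 4 (λ n w s s₂ → n :* (w :* s :+ s₂) := w :* (n :* s) :+ n :* s₂) refl (nat p) two _ _ ⟩
    two * (nat p * shift (b r) p) + nat p * shift (shift (b r)) p
      ≈⟨ +-cong (*-congˡ (euler-shift (b r) p)) (euler-shift² (b r) p) ⟩
    two * (shift Eb p + shift (b r) p) + (shift (shift Eb) p + two * shift (shift (b r)) p)
      ≈⟨ main r ⟩
    two * nat (suc r) * (shift (b r) p + shift (shift (b r)) p) ∎
    where
    Eb = λ q → nat q * b r q

    main : ∀ r → let Eb = λ q → nat q * b r q in
      two * (shift Eb p + shift (b r) p) + (shift (shift Eb) p + two * shift (shift (b r)) p) ≈
      two * nat (suc r) * (shift (b r) p + shift (shift (b r)) p)
    main zero = begin
      two * (shift Eb₀ p + s₁) + (shift (shift Eb₀) p + two * s₂)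
        ≈⟨ +-cong (*-congˡ (+-congʳ (shift-zero Eb₀≈0 p))) (+-congʳ (shift-zero (shift-zero Eb₀≈0) p)) ⟩
      two * (0# + s₁) + (0# + two * s₂)
        ≈⟨ solve 2 (λ a b → con (+ 2) :* (con (+ 0) :+ a) :+ (con (+ 0) :+ con (+ 2) :* b) :=
             con (+ 2) :* con (+ 1) :* (a :+ b)) refl s₁ s₂ ⟩
      two * nat 1 * (s₁ + s₂) ∎
      where
      s₁ = shift unit p
      s₂ = shift (shift unit) p
      Eb₀ = λ q → nat q * unit q
      Eb₀≈0 : ∀ q → Eb₀ q ≈ 0#
      Eb₀≈0 zero    = zeroˡ _
      Eb₀≈0 (suc q) = zeroʳ _
    main (suc r) = begin
      two * (shift Eb₁ p + shift (b (suc r)) p) + (shift (shift Eb₁) p + two * shift (shift (b (suc r))) p)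
        ≈⟨ +-cong (*-congˡ (+-cong e₁ e₂)) (+-cong e₃ (*-congˡ e₄)) ⟩
      two * (k * (s₂ + s₃) + (two * s₂ + s₃)) + (k * (s₃ + s₄) + two * (two * s₃ + s₄))
        ≈⟨ solve 4 (λ n s₂ s₃ s₄ → let k = con (+ 2) :* n ; w = con (+ 2) in
             w :* (k :* (s₂ :+ s₃) :+ (w :* s₂ :+ s₃)) :+ (k :* (s₃ :+ s₄) :+ w :* (w :* s₃ :+ s₄)) :=
             w :* (con (+ 1) :+ n) :* ((w :* s₂ :+ s₃) :+ (w :* s₃ :+ s₄))) refl (nat (suc r)) s₂ s₃ s₄ ⟩
      two * (nat 1 + nat (suc r)) * ((two * s₂ + s₃) + (two * s₃ + s₄))
        ≈⟨ *-cong (*-congˡ (+-congʳ (+-identityʳ 1#))) (+-cong (sym e₂) (sym e₄)) ⟩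
      two * nat (suc (suc r)) * (shift (b (suc r)) p + shift (shift (b (suc r))) p) ∎
      where
      k = two * nat (suc r)
      Eb₁ = λ q → nat q * b (suc r) q
      s₂ = shift (shift (b r)) p
      s₃ = shift (shift (shift (b r))) p
      s₄ = shift (shift (shift (shift (b r)))) p
      f₁ : ∀ q → shift Eb₁ q ≈ k * (shift (shift (b r)) q + shift (shift (shift (b r))) q)
      f₁ q = trans (shift-cong (euler-b r) q) (trans (shift-scale k _ q) (*-congˡ (shift-+ _ _ q)))
      f₂ : ∀ q → shift (b (suc r)) q ≈ two * shift (shift (b r)) q + shift (shift (shift (b r))) q
      f₂ q = trans (shift-+ _ _ q) (+-congʳ (shift-scale two _ q))
      e₁ = f₁ p
      e₂ = f₂ p
      e₃ : shift (shift Eb₁) p ≈ k * (s₃ + s₄)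
      e₃ = trans (shift-cong f₁ p) (trans (shift-scale k _ p) (*-congˡ (shift-+ _ _ p)))
      e₄ : shift (shift (b (suc r))) p ≈ two * s₃ + s₄
      e₄ = trans (shift-cong f₂ p) (trans (shift-+ _ _ p) (+-congʳ (shift-scale two _ p)))

  sign : ℕ → Carrier
  sign zero    = 1#
  sign (suc r) = - sign r

  sign≉0 : ∀ r → ¬ (sign r ≈ 0#)
  sign≉0 zero    e = 1≉0 e
  sign≉0 (suc r) e = sign≉0 r (trans (solve 1 (λ x → x := con (+ 0) :- (:- x)) refl (sign r)) (x-x≈0 (sym e)))

  -- The coefficients of log (1 + t).
  γ : ℕ → Carrier
  γ zero    = 0#
  γ (suc r) = sign r * proj₁ (inverse (nat (suc r)) (char-K r))

  nat*γ : ∀ r → nat (suc r) * γ (suc r) ≈ sign r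
  nat*γ r with inverse (nat (suc r)) (char-K r)
  ... | i , ni≈1 = begin
    nat (suc r) * (sign r * i)   ≈⟨ solve 3 (λ n s i → n :* (s :* i) := s :* (n :* i)) refl (nat (suc r)) (sign r) i ⟩
    sign r * (nat (suc r) * i)   ≈⟨ *-congˡ ni≈1 ⟩
    sign r * 1#                  ≈⟨ *-identityʳ _ ⟩
    sign r                       ∎

  γ≉0 : ∀ r → ¬ (γ (suc r) ≈ 0#)
  γ≉0 r e = sign≉0 r (trans (sym (nat*γ r)) (x≈0⇒y*x≈0 _ e))

  γ-1 : γ 1 ≈ 1#
  γ-1 = trans (trans (sym (*-identityˡ _)) (*-congʳ (sym (+-identityʳ 1#)))) (nat*γ 0)

  -- If `c r` lists the coefficients of s ^ r, this is the coefficient of t ^ p in log (1 + s)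
  -- truncated after s ^ n. It is kept abstract in `c` to serve both s = 2 t + t² (`b`) and s = T -
  -- 1 (`β`).
  logSum : (ℕ → ℕ → Carrier) → ℕ → ℕ → Carrier
  logSum c zero    p = 0#
  logSum c (suc n) p = logSum c n p + γ (suc n) * c (suc n) p

  -- The geometric series of 1 / (1 + t)² with ratio -(2 t + t²), cut after n terms. It enters as
  -- the logarithmic derivative: t d/dt of `logSum b n` is 2 (t + t²) times it.
  geomSum : ℕ → ℕ → Carrier
  geomSum zero    p = 0#
  geomSum (suc n) p = geomSum n p + sign n * b n p

  euler-logSum : ∀ n p → nat p * logSum b n p ≈ two * (shift (geomSum n) p + shift (shift (geomSum n)) p)
  euler-logSum zero    p = trans (zeroʳ _) (sym (x≈0⇒y*x≈0 two
    (x≈0∧y≈0⇒x+y≈0 (shift-zero (λ _ → refl) p) (shift-zero (shift-zero (λ _ → refl)) p))))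
  euler-logSum (suc n) p = begin
    nat p * (logSum b n p + γ (suc n) * b (suc n) p)
      ≈⟨ solve 4 (λ n l g b → n :* (l :+ g :* b) := n :* l :+ g :* (n :* b)) refl (nat p) _ _ _ ⟩
    nat p * logSum b n p + γ (suc n) * (nat p * b (suc n) p)
      ≈⟨ +-cong (euler-logSum n p) (*-congˡ (euler-b n p)) ⟩
    two * (u₁ + u₂) + γ (suc n) * (two * nat (suc n) * (b₁ + b₂))
      ≈⟨ solve 7 (λ w u₁ u₂ g n b₁ b₂ → w :* (u₁ :+ u₂) :+ g :* (w :* n :* (b₁ :+ b₂)) :=
           w :* ((u₁ :+ (n :* g) :* b₁) :+ (u₂ :+ (n :* g) :* b₂))) refl two u₁ u₂ (γ (suc n)) (nat (suc n)) b₁ b₂ ⟩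
    two * ((u₁ + nat (suc n) * γ (suc n) * b₁) + (u₂ + nat (suc n) * γ (suc n) * b₂))
      ≈⟨ *-congˡ (+-cong (+-congˡ (*-congʳ (nat*γ n))) (+-congˡ (*-congʳ (nat*γ n)))) ⟩
    two * ((u₁ + sign n * b₁) + (u₂ + sign n * b₂))
      ≈⟨ *-congˡ (+-cong (sym (shift-linear (geomSum n) (sign n) (b n) p))
           (sym (trans (shift-cong (shift-linear (geomSum n) (sign n) (b n)) p) (shift-linear _ (sign n) _ p)))) ⟩
    two * (shift (geomSum (suc n)) p + shift (shift (geomSum (suc n))) p) ∎
    where
    u₁ = shift (geomSum n) p
    u₂ = shift (shift (geomSum n)) p
    b₁ = shift (b n) p
    b₂ = shift (shift (b n)) p

  -- (1 + 2 t + t²) geomSum = 1 ∓ (2 t + t²) ^ n.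
  geomSum-telescope : ∀ n p →
    geomSum n p + (two * shift (geomSum n) p + shift (shift (geomSum n)) p) ≈ unit p - sign n * b n p
  geomSum-telescope zero    p = trans
    (x≈0∧y≈0⇒x+y≈0 refl (x≈0∧y≈0⇒x+y≈0 (x≈0⇒y*x≈0 two (shift-zero (λ _ → refl) p)) (shift-zero (shift-zero (λ _ → refl)) p)))
    (sym (x-x≈0 (sym (*-identityˡ _))))
  geomSum-telescope (suc n) p = begin
    (u + sign n * b n p) + (two * shift (geomSum (suc n)) p + shift (shift (geomSum (suc n))) p)
      ≈⟨ +-congˡ (+-cong (*-congˡ (shift-linear (geomSum n) (sign n) (b n) p))
           (trans (shift-cong (shift-linear (geomSum n) (sign n) (b n)) p) (shift-linear _ (sign n) _ p))) ⟩
    (u + sign n * b n p) + (two * (u₁ + sign n * b₁) + (u₂ + sign n * b₂))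
      ≈⟨ solve 8 (λ u u₁ u₂ s b₀ b₁ b₂ w → (u :+ s :* b₀) :+ (w :* (u₁ :+ s :* b₁) :+ (u₂ :+ s :* b₂)) :=
           (u :+ (w :* u₁ :+ u₂)) :+ s :* (b₀ :+ (w :* b₁ :+ b₂))) refl u u₁ u₂ (sign n) (b n p) b₁ b₂ two ⟩
    (u + (two * u₁ + u₂)) + sign n * (b n p + b (suc n) p)
      ≈⟨ +-congʳ (geomSum-telescope n p) ⟩
    (unit p - sign n * b n p) + sign n * (b n p + b (suc n) p)
      ≈⟨ solve 4 (λ e s a c → (e :- s :* a) :+ s :* (a :+ c) := e :- (:- s) :* c) refl (unit p) (sign n) (b n p) (b (suc n) p) ⟩
    unit p - sign (suc n) * b (suc n) p ∎
    where
    u  = geomSum n p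
    u₁ = shift (geomSum n) p
    u₂ = shift (shift (geomSum n)) p
    b₁ = shift (b n) p
    b₂ = shift (shift (b n)) p

  -- With v = (1 + t) `geomSum n`, the telescoping identity says (1 + t) v = 1 below degree n, so v
  -- starts like 1 / (1 + t).
  geomSum-sign : ∀ n p → p < n → geomSum n p + shift (geomSum n) p ≈ sign p
  geomSum-sign n zero p<n = begin
    u + 0#
      ≈⟨ solve 1 (λ u → u :+ con (+ 0) := u :+ (con (+ 2) :* con (+ 0) :+ con (+ 0))) refl u ⟩
    u + (two * 0# + 0#)
      ≈⟨ geomSum-telescope n 0 ⟩
    1# - sign n * b n 0
      ≈⟨ +-congˡ (-‿cong (x≈0⇒y*x≈0 _ (b-< n 0 p<n))) ⟩
    1# - 0#
      ≈⟨ solve 1 (λ a → a :- con (+ 0) := a) refl 1# ⟩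
    1# ∎
    where u = geomSum n 0
  geomSum-sign n (suc p) p<n = begin
    u′ + u
      ≈⟨ solve 3 (λ u′ u v → u′ :+ u := (u′ :+ (con (+ 2) :* u :+ v)) :- (u :+ v)) refl u′ u v ⟩
    (u′ + (two * u + v)) - (u + v)
      ≈⟨ +-cong (geomSum-telescope n (suc p)) (-‿cong (geomSum-sign n p (ℕₚ.<-trans (ℕₚ.n<1+n p) p<n))) ⟩
    (0# - sign n * b n (suc p)) - sign p
      ≈⟨ +-congʳ (+-congˡ (-‿cong (x≈0⇒y*x≈0 _ (b-< n (suc p) p<n)))) ⟩
    (0# - 0#) - sign p
      ≈⟨ solve 1 (λ a → (con (+ 0) :- con (+ 0)) :- a := :- a) refl (sign p) ⟩
    - sign p ∎
    where
    u′ = geomSum n (suc p)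
    u  = geomSum n p
    v  = shift (geomSum n) p

  -- log (1 + 2 t + t²) = 2 log (1 + t), up to degree n.
  logSum-b : ∀ n p → p ≤ n → logSum b n p ≈ two * γ p
  logSum-b n zero    _   = trans (constant-term n) (sym (zeroʳ two))
    where
    constant-term : ∀ n → logSum b n 0 ≈ 0#
    constant-term zero    = refl
    constant-term (suc n) = x≈0∧y≈0⇒x+y≈0 (constant-term n) (x≈0⇒y*x≈0 _ (b-< (suc n) 0 (s≤s z≤n)))
  -- Both sides are compared after applying t d/dt, which loses only the constant term;
  -- characteristic zero divides the factor p + 1 out again.
  logSum-b n (suc p) p<n = *-cancelˡ (char-K p) (begin
    nat (suc p) * logSum b n (suc p)
      ≈⟨ euler-logSum n (suc p) ⟩
    two * (geomSum n p + shift (geomSum n) p)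
      ≈⟨ *-congˡ (geomSum-sign n p p<n) ⟩
    two * sign p
      ≈⟨ *-congˡ (nat*γ p) ⟨
    two * (nat (suc p) * γ (suc p))
      ≈⟨ solve 3 (λ w n g → w :* (n :* g) := n :* (w :* g)) refl two _ _ ⟩
    nat (suc p) * (two * γ (suc p)) ∎)

  -- Let n = m + 1. The truncation after n + 1 terms would give 2 γ (n + 1), and the missing last
  -- term is γ (n + 1) times 2 ^ (n + 1). Their difference is nonzero because n + 1 > 1. This later
  -- turns an exact equation for g into the vanishing of (ad x) ^ (n + 1) a (1).
  logSum-b-next : ∀ m → ¬ (logSum b (suc m) (suc (suc m)) ≈ 0#)
  logSum-b-next m e = two^-injective-< {1} {suc (suc m)} (s≤s (s≤s z≤n)) (x-y≈0⇒x≈y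
    (*-cancel-0 (γ≉0 (suc m)) (begin
      γ n′ * (pow K two 1 - pow K two n′)
        ≈⟨ *-congˡ (+-congʳ (*-identityʳ two)) ⟩
      γ n′ * (two - pow K two n′)
        ≈⟨ solve 3 (λ g w q → g :* (w :- q) := w :* g :- g :* q) refl (γ n′) two (pow K two n′) ⟩
      two * γ n′ - γ n′ * pow K two n′
        ≈⟨ +-cong (sym (logSum-b n′ n′ ℕₚ.≤-refl)) (-‿cong (*-congˡ (sym (b-diagonal n′)))) ⟩
      (logSum b (suc m) n′ + γ n′ * b n′ n′) - γ n′ * b n′ n′
        ≈⟨ solve 2 (λ a c → (a :+ c) :- c := a) refl _ _ ⟩
      logSum b (suc m) n′
        ≈⟨ e ⟩
      0# ∎)))
    where n′ = suc (suc m)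

  hev-pow : ∀ S e n {w} → (∀ j → n < j → w j ≈ 0#) → hev S (e ℕ.+ n) w ≈ pow K S e * hev S n w
  hev-pow S zero    n h = sym (*-identityˡ _)
  hev-pow S (suc e) n h = trans (hev-suc S (e ℕ.+ n) (h _ (s≤s (ℕₚ.m≤n+m n e))))
    (trans (*-congˡ (hev-pow S e n h)) (sym (*-assoc _ _ _)))

  logSum-> : ∀ e {c : ℕ → ℕ → Carrier} → (∀ r p → r ℕ.* e < p → c r p ≈ 0#) → ∀ n p → n ℕ.* e < p → logSum c n p ≈ 0#
  logSum-> e h zero    p _ = refl
  logSum-> e h (suc n) p l = x≈0∧y≈0⇒x+y≈0
    (logSum-> e h n p (ℕₚ.≤-<-trans (ℕₚ.m≤n+m (n ℕ.* e) e) l)) (x≈0⇒y*x≈0 _ (h (suc n) p l))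

  -- An umbral substitution: θ p stands for t ^ p and Y is the homogenising variable. The hypothesis
  -- says that s has degree at most e, so s ^ r is homogenised to degree r e, and the whole sum to
  -- degree n e.
  hev-logSum : ∀ e {c : ℕ → ℕ → Carrier} → (∀ r p → r ℕ.* e < p → c r p ≈ 0#) → ∀ Y (θ : ℕ → Carrier) n →
    hev (pow K Y e) n (λ r → γ r * hev Y (r ℕ.* e) (λ p → c r p * θ p)) ≈ hev Y (n ℕ.* e) (λ p → logSum c n p * θ p)
  hev-logSum e {c} h Y θ zero    = trans (zeroˡ _) (sym (zeroˡ _))
  hev-logSum e {c} h Y θ (suc n) = begin
    pow K Y e * hev (pow K Y e) n (λ r → γ r * hev Y (r ℕ.* e) (λ p → c r p * θ p)) +
      γ (suc n) * hev Y (suc n ℕ.* e) (λ p → c (suc n) p * θ p)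
      ≈⟨ +-congʳ (*-congˡ (hev-logSum e h Y θ n)) ⟩
    pow K Y e * hev Y (n ℕ.* e) (λ p → logSum c n p * θ p) + γ (suc n) * hev Y (suc n ℕ.* e) (λ p → c (suc n) p * θ p)
      -- The factor Y ^ e is absorbed by lengthening the sum, since the additional coefficients
      -- vanish.
      ≈⟨ +-cong (sym (hev-pow Y e (n ℕ.* e) (λ p l → x≈0⇒x*y≈0 _ (logSum-> e h n p l))))
                (sym (hev-scale Y (suc n ℕ.* e) (γ (suc n)) _)) ⟩
    hev Y (suc n ℕ.* e) (λ p → logSum c n p * θ p) + hev Y (suc n ℕ.* e) (λ p → γ (suc n) * (c (suc n) p * θ p))
      ≈⟨ hev-+ Y (suc n ℕ.* e) _ _ ⟨
    hev Y (suc n ℕ.* e) (λ p → logSum c n p * θ p + γ (suc n) * (c (suc n) p * θ p))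
      ≈⟨ hev-congʳ (suc n ℕ.* e) (λ p → solve 4 (λ l g c θ → l :* θ :+ g :* (c :* θ) := (l :+ g :* c) :* θ) refl
           (logSum c n p) (γ (suc n)) (c (suc n) p) (θ p)) ⟩
    hev Y (suc n ℕ.* e) (λ p → logSum c (suc n) p * θ p) ∎

  -- β r j is the coefficient of T ^ j in (T - 1) ^ r.
  β : ℕ → ℕ → Carrier
  β zero    j = unit j
  β (suc r) j = shift (β r) j - β r j

  β-> : ∀ r j → r < j → β r j ≈ 0#
  β-> zero    (suc j) _       = refl
  β-> (suc r) (suc j) (s≤s l) = x-x≈0 (trans (β-> r j l) (sym (β-> r (suc j) (ℕₚ.m≤n⇒m≤1+n l))))

  sum1to-cong : ∀ n {g h} → (∀ j → j ≤ n → g j ≈ h j) → sum1to K n g ≈ sum1to K n h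
  sum1to-cong zero    e = refl
  sum1to-cong (suc n) e = +-cong (sum1to-cong n (λ j j≤n → e j (ℕₚ.m≤n⇒m≤1+n j≤n))) (e (suc n) ℕₚ.≤-refl)

  sum1to-scale : ∀ n k g → sum1to K n (λ j → k * g j) ≈ k * sum1to K n g
  sum1to-scale zero    k g = sym (zeroʳ k)
  sum1to-scale (suc n) k g = trans (+-congʳ (sum1to-scale n k g)) (sym (distribˡ _ _ _))

  -- The sum in (iii) starts at j = 1; the term j = 0 is lost harmlessly because θ j will be a (x ^
  -- j) with a (1) = 0.
  hev-sum1to : ∀ Y n (l θ : ℕ → Carrier) → θ 0 ≈ 0# →
    hev Y n (λ j → l j * θ j) ≈ sum1to K n (λ j → l j * pow K Y (n ∸ j) * θ j)
  hev-sum1to Y zero    l θ θ0 = x≈0⇒y*x≈0 _ θ0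
  hev-sum1to Y (suc n) l θ θ0 = +-cong
    (begin
      Y * hev Y n (λ j → l j * θ j)
        ≈⟨ *-congˡ (hev-sum1to Y n l θ θ0) ⟩
      Y * sum1to K n (λ j → l j * pow K Y (n ∸ j) * θ j)
        ≈⟨ sum1to-scale n Y _ ⟨
      sum1to K n (λ j → Y * (l j * pow K Y (n ∸ j) * θ j))
        ≈⟨ sum1to-cong n (λ j j≤n → trans
             (solve 4 (λ y l p θ → y :* (l :* p :* θ) := l :* (y :* p) :* θ) refl Y (l j) (pow K Y (n ∸ j)) (θ j))
             (reflexive (≡.cong (λ i → l j * pow K Y i * θ j) (≡.sym (ℕₚ.+-∸-assoc 1 j≤n))))) ⟩
      sum1to K n (λ j → l j * pow K Y (suc n ∸ j) * θ j) ∎)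
    (trans (*-congʳ (sym (*-identityʳ _)))
      (reflexive (≡.cong (λ i → l (suc n) * pow K Y i * θ (suc n)) (≡.sym (ℕₚ.n∸n≡0 n)))))

-- Additive maps over the field extension

module Extension {c₁ ℓ₁ c₂ ℓ₂} (F : CommutativeRing c₁ ℓ₁) (K : CommutativeRing c₂ ℓ₂)
  (field-K : IsField K) (char-K : CharZero K)
  (ι : CommutativeRing.Carrier F → CommutativeRing.Carrier K) (emb : IsEmbedding F K ι) where

  private
    module F = CommutativeRing F
    module FR = RingTools F
    module FS = FR.Solver
    module ι = IsEmbedding emb
  open CommutativeRing K hiding (zero)
  open RingTools K
  open Solver using (solve; _:+_; _:*_; _:-_; :-_; con; _:=_)
  open FieldTools K field-K char-K
  open Relation.Binary.Reasoning.Setoid setoid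

  ι-0 : ι F.0# ≈ 0#
  ι-0 = x+x≈x⇒x≈0 (trans (ι.cong (F.sym (F.+-identityˡ F.0#))) (ι.+-hom _ _))

  ι-nat : ∀ t → ι (FR.nat t) ≈ nat t
  ι-nat zero    = ι-0
  ι-nat (suc t) = trans (ι.+-hom _ _) (+-cong ι.1-hom (ι-nat t))

  infixl 6 _+[_]_ _+ₙ_

  _+[_]_ : F.Carrier → ℕ → F.Carrier → F.Carrier
  y +[ t ] z = y F.+ FR.nat t F.* z

  _+ₙ_ : F.Carrier → ℕ → F.Carrier
  x +ₙ s = x F.+ FR.nat s

  ι-+ₙ : ∀ x s → ι (x +ₙ s) ≈ ι x + nat s
  ι-+ₙ x s = trans (ι.+-hom _ _) (+-congˡ (ι-nat s))

  top-ι-+ₙ : ∀ x → Top 1 1# (λ t → ι (x +ₙ t))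
  top-ι-+ₙ x = top-cong (+-identityˡ 1#) (λ t → sym (ι-+ₙ x t))
    (top-+ (top-weaken (top-const (ι x))) top-nat)

  module Additivity {d : F.Carrier → Carrier} (d-cong : CongFun F K d) (d-+ : Additive F K d) where

    additive-0 : d F.0# ≈ 0#
    additive-0 = x+x≈x⇒x≈0 (trans (d-cong (F.sym (F.+-identityˡ F.0#))) (d-+ _ _))

    additive-nat-* : ∀ t z → d (FR.nat t F.* z) ≈ nat t * d z
    additive-nat-* zero    z = trans (d-cong (F.zeroˡ z)) (trans additive-0 (sym (zeroˡ _)))
    additive-nat-* (suc t) z = begin
      d ((F.1# F.+ FR.nat t) F.* z)      ≈⟨ d-cong (F.trans (F.distribʳ _ _ _) (F.+-congʳ (F.*-identityˡ z))) ⟩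
      d (z F.+ FR.nat t F.* z)           ≈⟨ d-+ _ _ ⟩
      d z + d (FR.nat t F.* z)           ≈⟨ +-cong (sym (*-identityˡ _)) (additive-nat-* t z) ⟩
      1# * d z + nat t * d z             ≈⟨ distribʳ _ _ _ ⟨
      (1# + nat t) * d z                 ∎

    additive-+[] : ∀ y t z → d (y +[ t ] z) ≈ d y + nat t * d z
    additive-+[] y t z = trans (d-+ _ _) (+-congˡ (additive-nat-* t z))

  -- Multiadditive maps and their expansion under x + s

  -- Arguments are vectors rather than functions on `Fin n`, so that fixing the first argument
  -- computes and inductions can run over the number of arguments.
  Map : ℕ → Set (c₁ ⊔ c₂)
  Map n = Vec F.Carrier n → Carrier

  infixl 9 _·_

  _·_ : ∀ {n} → Map (suc n) → F.Carrier → Map n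
  (A · x) v = A (x ∷ v)

  data MultiAdd : ∀ {n} → Map n → Set (c₁ ⊔ ℓ₁ ⊔ c₂ ⊔ ℓ₂) where
    nullary : {A : Map 0} → MultiAdd A
    curried : ∀ {n} {A : Map (suc n)} →
              (∀ v → CongFun F K (λ x → A (x ∷ v))) → (∀ v → Additive F K (λ x → A (x ∷ v))) →
              (∀ x → MultiAdd (A · x)) → MultiAdd A

  multiAdd-+[] : ∀ {n} {A : Map (suc n)} → MultiAdd A → ∀ y t z v →
                 (A · (y +[ t ] z)) v ≈ (A · y) v + nat t * (A · z) v
  multiAdd-+[] (curried cg ad _) y t z v = Additivity.additive-+[] (cg v) (ad v) y t z

  multiAdd-+ₙ : ∀ {n} {A : Map (suc n)} → MultiAdd A → ∀ y t v →
                 (A · (y +ₙ t)) v ≈ (A · y) v + nat t * (A · F.1#) v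
  multiAdd-+ₙ M@(curried cg ad _) y t v =
    trans (cg v (F.+-congˡ (F.sym (F.*-identityʳ _)))) (multiAdd-+[] M y t F.1# v)

  multiAdd-· : ∀ {n} {A : Map (suc n)} → MultiAdd A → ∀ x → MultiAdd (A · x)
  multiAdd-· (curried _ _ M) = M

  trace : ∀ {n} → Map n → F.Carrier → Carrier
  trace {n} A x = A (replicate n x)

  trace-cong : ∀ {n} {A : Map n} → MultiAdd A → CongFun F K (trace A)
  trace-cong nullary          e = refl
  trace-cong (curried cg _ M) e = trans (cg _ e) (trace-cong (M _) e)

  -- comp j A is the sum of all ways of specialising all but j arguments of A to 1, restricted to the diagonal.
  comp : ∀ {n} → ℕ → Map n → F.Carrier → Carrier
  comp {zero}  zero    A x = A []
  comp {zero}  (suc j) A x = 0#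
  comp {suc n} zero    A x = comp zero (A · F.1#) x
  comp {suc n} (suc j) A x = comp j (A · x) x + comp (suc j) (A · F.1#) x

  comp-cong : ∀ {n} j {A B : Map n} x → (∀ v → A v ≈ B v) → comp j A x ≈ comp j B x
  comp-cong {zero}  zero    x e = e []
  comp-cong {zero}  (suc j) x e = refl
  comp-cong {suc n} zero    x e = comp-cong zero x (λ v → e (F.1# ∷ v))
  comp-cong {suc n} (suc j) x e = +-cong (comp-cong j x (λ v → e (x ∷ v))) (comp-cong (suc j) x (λ v → e (F.1# ∷ v)))

  comp-linear : ∀ {n} j (A : Map n) k B x → comp j (λ v → A v + k * B v) x ≈ comp j A x + k * comp j B x
  comp-linear {zero}  zero    A k B x = refl
  comp-linear {zero}  (suc j) A k B x = sym (trans (+-identityˡ _) (zeroʳ k))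
  comp-linear {suc n} zero    A k B x = comp-linear zero (A · F.1#) k (B · F.1#) x
  comp-linear {suc n} (suc j) A k B x = trans
    (+-cong (comp-linear j (A · x) k (B · x) x) (comp-linear (suc j) (A · F.1#) k (B · F.1#) x))
    (solve 5 (λ k a b c d → (a :+ k :* b) :+ (c :+ k :* d) := (a :+ c) :+ k :* (b :+ d)) refl
      k (comp j (A · x) x) (comp j (B · x) x) (comp (suc j) (A · F.1#) x) (comp (suc j) (B · F.1#) x))

  comp-zero : ∀ {n} j {A : Map n} x → (∀ v → A v ≈ 0#) → comp j A x ≈ 0#
  comp-zero {zero}  zero    x e = e []
  comp-zero {zero}  (suc j) x e = refl
  comp-zero {suc n} zero    x e = comp-zero zero x (λ v → e (F.1# ∷ v))
  comp-zero {suc n} (suc j) x e =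
    x≈0∧y≈0⇒x+y≈0 (comp-zero j x (λ v → e (x ∷ v))) (comp-zero (suc j) x (λ v → e (F.1# ∷ v)))

  comp-+[] : ∀ {n} {A : Map (suc n)} j → MultiAdd A → ∀ y t z x →
             comp j (A · (y +[ t ] z)) x ≈ comp j (A · y) x + nat t * comp j (A · z) x
  comp-+[] {A = A} j M y t z x = trans (comp-cong j x (multiAdd-+[] M y t z)) (comp-linear j (A · y) (nat t) (A · z) x)

  comp-> : ∀ {n} j (A : Map n) x → n < j → comp j A x ≈ 0#
  comp-> {zero}  (suc j) A x _         = refl
  comp-> {suc n} (suc j) A x (s≤s n<j) =
    x≈0∧y≈0⇒x+y≈0 (comp-> j (A · x) x n<j) (comp-> (suc j) (A · F.1#) x (ℕₚ.m≤n⇒m≤1+n n<j))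

  -- In each summand j slots move along the line and the others stay at 1; taking the direction `z`
  -- in every moving slot gives the coefficient of t ^ j.
  comp-top : ∀ {n} j {A : Map n} → MultiAdd A → ∀ y z → Top j (comp j A z) (λ t → comp j A (y +[ t ] z))
  comp-top {zero}  zero    M y z = top-const _
  comp-top {zero}  (suc j) M y z = top-zero (suc j) (λ _ → refl)
  comp-top {suc n} zero    (curried _ _ M) y z = comp-top zero (M F.1#) y z
  comp-top {suc n} (suc j) {A} M y z = top-cong (+-congʳ (+-identityˡ _))
    (λ t → +-congʳ (sym (comp-+[] j M y t z (y +[ t ] z))))
    (top-+ (top-+ (top-weaken (comp-top j (multiAdd-· M y) y z))
                  (top-shift (comp-top j (multiAdd-· M z) y z)))
           (comp-top (suc j) (multiAdd-· M F.1#) y z))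

  trace-expand : ∀ {n} {A : Map n} → MultiAdd A → ∀ x s → trace A (x +ₙ s) ≈ hev (nat s) n (λ j → comp j A x)
  trace-expand {zero}      M x s = refl
  trace-expand {suc n} {A} M x s = begin
    trace (A · (x +ₙ s)) (x +ₙ s)
      ≈⟨ multiAdd-+ₙ M x s _ ⟩
    trace (A · x) (x +ₙ s) + nat s * trace (A · F.1#) (x +ₙ s)
      ≈⟨ +-cong (trace-expand (multiAdd-· M x) x s) (*-congˡ (trace-expand (multiAdd-· M F.1#) x s)) ⟩
    hev (nat s) n (λ j → comp j (A · x) x) + nat s * hev (nat s) n (λ j → comp j (A · F.1#) x)
      ≈⟨ +-congˡ (hev-suc (nat s) n {λ j → comp j (A · F.1#) x} (comp-> (suc n) (A · F.1#) x ℕₚ.≤-refl)) ⟨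
    hev (nat s) n (λ j → comp j (A · x) x) + hev (nat s) (suc n) (λ j → comp j (A · F.1#) x)
      ≈⟨ +-congˡ (hev-head (nat s) n _) ⟩
    hev (nat s) n (λ j → comp j (A · x) x) +
      (pow K (nat s) (suc n) * comp 0 (A · F.1#) x + hev (nat s) n (λ j → comp (suc j) (A · F.1#) x))
      ≈⟨ solve 3 (λ a b c → a :+ (b :+ c) := b :+ (a :+ c)) refl _ _ _ ⟩
    pow K (nat s) (suc n) * comp 0 (A · F.1#) x +
      (hev (nat s) n (λ j → comp j (A · x) x) + hev (nat s) n (λ j → comp (suc j) (A · F.1#) x))
      ≈⟨ +-congˡ (hev-+ (nat s) n _ _) ⟨
    pow K (nat s) (suc n) * comp 0 A x + hev (nat s) n (λ j → comp (suc j) A x)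
      ≈⟨ hev-head (nat s) n (λ j → comp j A x) ⟨
    hev (nat s) (suc n) (λ j → comp j A x) ∎

  -- Functions that decompose into parts

  -- The properties of a generalized monomial that enter the comparison of coefficients. They are
  -- attached to a function, not to a multiadditive map, because xⁿ and the logarithmic candidate
  -- are assembled by products with ι x and linear combinations, and a trace representation of them
  -- would have to be built separately.
  record Decomposition (n : ℕ) (h : F.Carrier → Carrier) : Set (c₁ ⊔ ℓ₁ ⊔ c₂ ⊔ ℓ₂) where
    field
      part     : ℕ → F.Carrier → Carrier
      h-cong   : CongFun F K h
      expand   : ∀ x s → h (x +ₙ s) ≈ hev (nat s) n (λ j → part j x)
      part->   : ∀ j x → n < j → part j x ≈ 0#
      part-top : ∀ j y z → Top j (part j z) (λ t → part j (y +[ t ] z))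

    part-n : ∀ x → part n x ≈ h x
    part-n x = trans (sym (hev-at-0 n (λ j → part j x) refl))
      (trans (sym (expand x 0)) (h-cong (F.+-identityʳ x)))

  open Decomposition

  trace-decomp : ∀ {n} {A : Map n} → MultiAdd A → Decomposition n (trace A)
  trace-decomp {A = A} M = record
    { part     = λ j x → comp j A x
    ; h-cong   = trace-cong M
    ; expand   = trace-expand M
    ; part->   = λ j x → comp-> j A x
    ; part-top = λ j → comp-top j M
    }

  trace-top : ∀ {n} {A : Map n} → MultiAdd A → ∀ y z → Top n (trace A z) (λ t → trace A (y +[ t ] z))
  trace-top {n} M y z = top-cong (part-n D z) (λ t → part-n D (y +[ t ] z)) (part-top D n y z)
    where D = trace-decomp M

  decomp-resp : ∀ {n h h′} → (∀ x → h x ≈ h′ x) → Decomposition n h → Decomposition n h′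
  decomp-resp e D = record
    { part     = part D
    ; h-cong   = λ x≈y → trans (sym (e _)) (trans (h-cong D x≈y) (e _))
    ; expand   = λ x s → trans (sym (e _)) (expand D x s)
    ; part->   = part-> D
    ; part-top = part-top D
    }

  decomp-linear : ∀ {n h h′} → Decomposition n h → ∀ k → Decomposition n h′ → Decomposition n (λ x → h x + k * h′ x)
  decomp-linear {n} D k D′ = record
    { part     = λ j x → part D j x + k * part D′ j x
    ; h-cong   = λ e → +-cong (h-cong D e) (*-congˡ (h-cong D′ e))
    ; expand   = λ x s → trans (+-cong (expand D x s) (*-congˡ (expand D′ x s)))
                   (sym (trans (hev-+ (nat s) n _ _) (+-congˡ (hev-scale (nat s) n k _))))
    ; part->   = λ j x n<j → x≈0∧y≈0⇒x+y≈0 (part-> D j x n<j) (x≈0⇒y*x≈0 k (part-> D′ j x n<j))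
    ; part-top = λ j y z → top-+ (part-top D j y z) (top-scale k (part-top D′ j y z))
    }

  decomp-const : ∀ a → Decomposition 0 (λ _ → a)
  decomp-const a = record
    { part     = λ { zero x → a ; (suc j) x → 0# }
    ; h-cong   = λ _ → refl
    ; expand   = λ x s → refl
    ; part->   = λ { (suc j) x _ → refl }
    ; part-top = λ { zero y z → top-const a ; (suc j) y z → top-zero (suc j) (λ _ → refl) }
    }

  decomp-ι* : ∀ {n h} → Decomposition n h → Decomposition (suc n) (λ x → ι x * h x)
  decomp-ι* {n} {h} D = record
    { part     = part′
    ; h-cong   = λ e → *-cong (ι.cong e) (h-cong D e)
    ; expand   = expand′
    ; part->   = λ { (suc j) x (s≤s n<j) → x≈0∧y≈0⇒x+y≈0
                     (x≈0⇒y*x≈0 (ι x) (part-> D j x n<j)) (part-> D (suc j) x (ℕₚ.m≤n⇒m≤1+n n<j)) }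
    ; part-top = part-top′
    }
    where
    part′ : ℕ → F.Carrier → Carrier
    part′ zero    x = part D zero x
    part′ (suc j) x = ι x * part D j x + part D (suc j) x

    expand′ : ∀ x s → ι (x +ₙ s) * h (x +ₙ s) ≈ hev (nat s) (suc n) (λ j → part′ j x)
    expand′ x s = begin
      ι (x +ₙ s) * h (x +ₙ s)
        ≈⟨ *-cong (ι-+ₙ x s) (expand D x s) ⟩
      (ι x + nat s) * hev (nat s) n w
        ≈⟨ distribʳ _ _ _ ⟩
      ι x * hev (nat s) n w + nat s * hev (nat s) n w
        ≈⟨ +-cong (sym (hev-scale (nat s) n (ι x) w)) (sym (hev-suc (nat s) n {w} (part-> D (suc n) x ℕₚ.≤-refl))) ⟩
      hev (nat s) n (λ j → ι x * w j) + hev (nat s) (suc n) w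
        ≈⟨ +-congˡ (hev-head (nat s) n w) ⟩
      hev (nat s) n (λ j → ι x * w j) + (pow K (nat s) (suc n) * w 0 + hev (nat s) n (λ j → w (suc j)))
        ≈⟨ solve 3 (λ a b c → a :+ (b :+ c) := b :+ (a :+ c)) refl _ _ _ ⟩
      pow K (nat s) (suc n) * w 0 + (hev (nat s) n (λ j → ι x * w j) + hev (nat s) n (λ j → w (suc j)))
        ≈⟨ +-congˡ (hev-+ (nat s) n _ _) ⟨
      pow K (nat s) (suc n) * w 0 + hev (nat s) n (λ j → part′ (suc j) x)
        ≈⟨ hev-head (nat s) n (λ j → part′ j x) ⟨
      hev (nat s) (suc n) (λ j → part′ j x) ∎
      where w = λ j → part D j x

    part-top′ : ∀ j y z → Top j (part′ j z) (λ t → part′ j (y +[ t ] z))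
    part-top′ zero    y z = part-top D zero y z
    part-top′ (suc j) y z = top-+
      (top-* (top-cong (+-identityˡ _) (λ t → sym (ι-+[] t))
               (top-+ (top-weaken (top-const (ι y))) (top-shift (top-const (ι z)))))
             (part-top D j y z))
      (part-top D (suc j) y z)
      where
      ι-+[] : ∀ t → ι (y +[ t ] z) ≈ ι y + nat t * ι z
      ι-+[] t = trans (ι.+-hom _ _) (+-congˡ (trans (ι.*-hom _ _) (*-congʳ (ι-nat t))))

  decomp-pow : ∀ n → Decomposition n (λ x → pow K (ι x) n)
  decomp-pow zero    = decomp-const 1#
  decomp-pow (suc n) = decomp-ι* (decomp-pow n)

  -- Comparing coefficients in the functional equation

  defect : ℕ → Carrier → (F.Carrier → Carrier) → F.Carrier → Carrier
  defect n κ h x = h (x F.* x) - κ * pow K (ι x) n * h x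

  -- Part k is tested in t-degree 2 n - k, which is at least n for k up to n, so an error of degree
  -- below n is invisible there. The slack is made for the truncated logarithm; f itself has defect
  -- zero.
  SmallDefect : ℕ → Carrier → (F.Carrier → Carrier) → Set (c₁ ⊔ c₂ ⊔ ℓ₂)
  SmallDefect n κ h = ∀ x → ∃ λ d → ∃ λ a → d < n × Top d a (λ t → defect n κ h (x +ₙ t))

  -- The square is a point on the line x² + 2 t x, shifted by the natural number t². Expanding in
  -- the shift, part j contributes degree 2 (n - j) from the shift and a top coefficient with the
  -- factor 2 ^ j from the line.
  +ₙ-square : ∀ x t → (x +ₙ t) F.* (x +ₙ t) F.≈ (x F.* x) +[ 2 ℕ.* t ] x +ₙ (t ℕ.* t)
  +ₙ-square x t = F.trans
    (FS.solve 2 (λ x t → (x FS.:+ t) FS.:* (x FS.:+ t) FS.:=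
        x FS.:* x FS.:+ FS.con (+ 2) FS.:* t FS.:* x FS.:+ t FS.:* t) F.refl x (FR.nat t))
    (F.+-cong (F.+-congˡ (F.*-congʳ (F.sym (FR.nat-* 2 t)))) (F.sym (FR.nat-* t t)))

  -- Comparing the coefficients of t ^ (2 n - k) in h ((x + t)²) and κ (x + t)ⁿ h (x + t).
  part-vanish : ∀ {n κ h} (D : Decomposition n h) → SmallDefect n κ h → ∀ k q → n ≡ q ℕ.+ k →
    (∀ j → j < k → ∀ x → part D j x ≈ 0#) → ¬ (κ ≈ pow K two k) → ∀ x → part D k x ≈ 0#
  part-vanish {κ = κ} {h} D small k q ≡.refl low κ≉ x = *-cancel-0 2ᵏ-κ≉0 (begin
    (pow K two k - κ) * part D k x
      ≈⟨ solve 3 (λ a b p → (a :- b) :* p := a :* p :- b :* (con (+ 1) :* p)) refl (pow K two k) κ (part D k x) ⟩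
    pow K two k * part D k x - κ * (nat 1 * part D k x)
      ≈⟨ +-congˡ (-‿cong (*-congˡ (*-congʳ (+-identityʳ 1#)))) ⟩
    pow K two k * part D k x - κ * (1# * part D k x)
      ≈⟨ top-unique (top-+ lhs (top-neg rhs)) (error (small x)) (λ t → +-congˡ (-‿cong (sym (*-assoc _ _ _)))) ⟩
    0# ∎)
    where
    n = q ℕ.+ k

    2ᵏ-κ≉0 : ¬ (pow K two k - κ ≈ 0#)
    2ᵏ-κ≉0 e = κ≉ (sym (x-y≈0⇒x≈y e))

    deg : q ℕ.* 2 ℕ.+ k ℕ.* 1 ≡ n ℕ.* 1 ℕ.+ (q ℕ.* 1 ℕ.+ k ℕ.* 0)
    deg = +-*-Solver.solve 2 (λ q k → q :*′ con′ 2 :+′ k :*′ con′ 1 :=′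
            (q :+′ k) :*′ con′ 1 :+′ (q :*′ con′ 1 :+′ k :*′ con′ 0)) ≡.refl q k
      where open +-*-Solver using () renaming (_:+_ to _:+′_; _:*_ to _:*′_; con to con′; _:=_ to _:=′_)

    lhs : Top (q ℕ.* 2 ℕ.+ k ℕ.* 1) (pow K two k * part D k x) (λ t → h ((x +ₙ t) F.* (x +ₙ t)))
    lhs = top-cong refl
      (λ t → sym (trans (h-cong D (+ₙ-square x t)) (expand D ((x F.* x) +[ 2 ℕ.* t ] x) (t ℕ.* t))))
      (hev-top 1 k q {λ t → nat (t ℕ.* t)} {λ j t → part D j ((x F.* x) +[ 2 ℕ.* t ] x)}
        (λ j → pow K two j * part D j x)
        (top-cong (*-identityˡ 1#) (λ t → sym (nat-* t t)) (top-* top-nat top-nat))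
        (λ j j<k t → low j j<k _)
        (λ j → top-degree (≡.sym (ℕₚ.*-identityʳ j)) (top-double (part-top D j (x F.* x) x))))

    rhs : Top (q ℕ.* 2 ℕ.+ k ℕ.* 1) (κ * (1# * part D k x)) (λ t → κ * (pow K (ι (x +ₙ t)) n * h (x +ₙ t)))
    rhs = top-degree (≡.sym deg) (top-scale κ (top-* (top-pow n (top-ι-+ₙ x))
      (top-cong refl (λ t → sym (expand D x t))
        (hev-top 0 k q {nat} {λ j _ → part D j x} (λ j → part D j x) top-nat (λ j j<k _ → low j j<k x)
          (λ j → top-degree (≡.sym (ℕₚ.*-zeroʳ j)) (top-const _))))))

    error : (∃ λ d → ∃ λ a → d < n × Top d a (λ t → defect n κ h (x +ₙ t))) →
            Top (q ℕ.* 2 ℕ.+ k ℕ.* 1) 0# (λ t → defect n κ h (x +ₙ t))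
    error (d , a , d<n , p) = top-weaken-< (ℕₚ.<-≤-trans d<n n≤) p
      where
      n≤ : n ≤ q ℕ.* 2 ℕ.+ k ℕ.* 1
      n≤ = ℕₚ.+-mono-≤ (ℕₚ.m≤m*n q 2) (ℕₚ.m≤m*n k 1)

  -- Induction on k₁. The parts below k₀ are those known to vanish for another reason, which is how
  -- an exponent with κ = 2 ^ k is stepped over: k₀ is 1 for κ = 1 and 2 for the main comparison
  -- with κ = 2.
  parts-vanish : ∀ {n κ h} (D : Decomposition n h) → SmallDefect n κ h → ∀ k₀ k₁ → k₁ ≤ suc n →
    (∀ j → j < k₀ → ∀ x → part D j x ≈ 0#) → (∀ k → k₀ ≤ k → k < k₁ → ¬ (κ ≈ pow K two k)) →
    ∀ j → j < k₁ → ∀ x → part D j x ≈ 0#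
  parts-vanish D small k₀ (suc k) (s≤s k≤n) low κ≉ j (s≤s j≤k) with k ℕ.<? k₀
  ... | yes k<k₀ = low j (ℕₚ.≤-<-trans j≤k k<k₀)
  ... | no  k≮k₀ = last (ℕₚ.m≤n⇒m<n∨m≡n j≤k)
    where
    below : ∀ j → j < k → ∀ x → part D j x ≈ 0#
    below = parts-vanish D small k₀ k (ℕₚ.m≤n⇒m≤1+n k≤n) low (λ i k₀≤i i<k → κ≉ i k₀≤i (ℕₚ.m≤n⇒m≤1+n i<k))

    last : (j < k) ⊎ (j ≡ k) → ∀ x → part D j x ≈ 0#
    last (inj₁ j<k)    = below j j<k
    last (inj₂ ≡.refl) = part-vanish D small k _ (≡.sym (ℕₚ.m∸n+n≡m k≤n)) below (κ≉ k (ℕₚ.≮⇒≥ k≮k₀) ℕₚ.≤-refl)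

  -- From the trace to the symmetrised map

  open Alternation K

  multiAdd-0 : ∀ {n} {A : Map (suc n)} → MultiAdd A → ∀ v → (A · F.0#) v ≈ 0#
  multiAdd-0 (curried cg ad _) v = Additivity.additive-0 (cg v) (ad v)

  multiAdd-sumList : ∀ {n} {A : Map (suc n)} → MultiAdd A → ∀ {b} {B : Set b} (is : List B) φ v →
                     (A · sumList F is φ) v ≈ sumList K is (λ i → (A · φ i) v)
  multiAdd-sumList M                  []       φ v = multiAdd-0 M v
  multiAdd-sumList M@(curried cg ad _) (i ∷ is) φ v = trans (ad v _ _) (+-congˡ (multiAdd-sumList M is φ v))

  subsetSum : ∀ {N} → (Fin N → F.Carrier) → Vec Bool N → F.Carrier
  subsetSum {N} xs c = sumList F (allFin N) (λ i → if lookup c i then xs i else F.0#)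

  trace-subsetSum : ∀ {m N} {A : Map m} → MultiAdd A → (xs : Fin N → F.Carrier) (c : Vec Bool N) →
    trace A (subsetSum xs c) ≈ sumList K (allFuns m N) (λ g → covers c g * A (tabulate (xs ∘ g)))
  trace-subsetSum {zero} M xs c = sym (trans (+-identityʳ _) (*-identityˡ _))
  trace-subsetSum {suc m} {N} {A} M xs c = begin
    (A · y) (replicate m y)
      ≈⟨ multiAdd-sumList M (allFin N) _ _ ⟩
    sumList K (allFin N) (λ i → trace (A · (if lookup c i then xs i else F.0#)) y)
      ≈⟨ sumList-cong (allFin N) (λ i → trans (select i (lookup c i) _) (*-congˡ (trace-subsetSum (multiAdd-· M (xs i)) xs c))) ⟩
    sumList K (allFin N) (λ i → indicator (lookup c i) *
      sumList K (allFuns m N) (λ g → covers c g * A (xs i ∷ tabulate (xs ∘ g))))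
      ≈⟨ sumList-cong (allFin N) (λ i → trans (sym (sumList-scale _ (allFuns m N) _))
           (trans (sumList-cong (allFuns m N) (λ g → sym (*-assoc _ _ _))) (sym (sumList-map _ (allFuns m N) _)))) ⟩
    sumList K (allFin N) (λ i → sumList K (map _ (allFuns m N)) (λ g → covers c g * A (tabulate (xs ∘ g))))
      ≈⟨ sumList-concatMap _ (allFin N) _ ⟨
    sumList K (allFuns (suc m) N) (λ g → covers c g * A (tabulate (xs ∘ g))) ∎
    where
    y = subsetSum xs c
    select : ∀ i b v → (A · (if b then xs i else F.0#)) v ≈ indicator b * (A · xs i) v
    select i true  v = sym (*-identityˡ _)
    select i false v = trans (multiAdd-0 M v) (sym (zeroˡ _))

  -- Evaluate the trace at all partial sums of the xs and alternate over the subsets: only the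
  -- bijective index functions survive. The list `Sym` is a filter of all functions, so its
  -- indicator is exactly what `alternate-covers` supplies. The map to which this is applied need
  -- not be symmetric, hence the sum over permutations in (iv).
  symmetrization-vanish : ∀ {N} {A : Map N} → MultiAdd A → (∀ x → trace A x ≈ 0#) → ∀ xs →
    sumList K (Sym N) (λ σ → A (tabulate (xs ∘ σ))) ≈ 0#
  symmetrization-vanish {N} {A} M tr≈0 xs = begin
    sumList K (Sym N) (λ σ → A (tabulate (xs ∘ σ)))
      ≈⟨ sumList-filterᵇ isInjectiveᵇ (allFuns N N) _ ⟩
    sumList K (allFuns N N) (λ g → indicator (isInjectiveᵇ g) * A (tabulate (xs ∘ g)))
      ≈⟨ sumList-cong (allFuns N N) (λ g → trans (*-congʳ (sym (alternate-covers g))) (sym (alternate-scale {N} _ _))) ⟩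
    sumList K (allFuns N N) (λ g → alternate (λ c → covers c g * A (tabulate (xs ∘ g))))
      ≈⟨ alternate-sumList {N} (allFuns N N) _ ⟨
    alternate (λ c → sumList K (allFuns N N) (λ g → covers c g * A (tabulate (xs ∘ g))))
      ≈⟨ alternate-0 (λ c → trans (sym (trace-subsetSum M xs c)) (tr≈0 _)) ⟩
    0# ∎

  -- First polars and symmetry

  -- The first polar form: the sum over all slots with y in that slot and x in the others.
  polar : ∀ {n} → Map n → F.Carrier → F.Carrier → Carrier
  polar {zero}  A x y = 0#
  polar {suc n} A x y = trace (A · y) x + polar (A · x) x y

  -- The leading term is subtracted so that the second coefficient becomes the top one, the only one
  -- that `Top` records. `pow-ι-top` uses the same device for powers.
  polar-top : ∀ {m} {A : Map (suc m)} → MultiAdd A → ∀ y z →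
    Top m (polar A z y) (λ t → trace A (y +[ t ] z) - pow K (nat t) (suc m) * trace A z)
  polar-top {zero} {A} M y z = constant λ t → trans
    (+-cong (multiAdd-+[] M y t z []) (-‿cong (*-congʳ (*-identityʳ _))))
    (solve 3 (λ a n b → (a :+ n :* b) :- n :* b := a :+ con (+ 0)) refl _ _ _)
  polar-top {suc m} {A} M y z = top-cong refl
    (λ t → trans
      (solve 5 (λ a n b p c → a :+ n :* (b :- p :* c) := (a :+ n :* b) :- (n :* p) :* c) refl _ _ _ _ _)
      (+-congʳ (sym (multiAdd-+[] M y t z _))))
    (top-+ (trace-top (multiAdd-· M y) y z) (top-shift (polar-top (multiAdd-· M z) y z)))

  -- Invariance under exchanging neighbouring arguments is enough to move y to the front in `polar`,
  -- and this form passes directly to `A · x`.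
  data Swappable : ∀ {n} → Map n → Set (c₁ ⊔ c₂ ⊔ ℓ₂) where
    unary : {A : Map 1} → Swappable A
    swap  : ∀ {n} {A : Map (suc (suc n))} →
            (∀ x y v → A (x ∷ y ∷ v) ≈ A (y ∷ x ∷ v)) → (∀ x → Swappable (A · x)) → Swappable A

  polar-swappable : ∀ {m} {A : Map (suc m)} → Swappable A → ∀ x y → polar A x y ≈ nat (suc m) * trace (A · y) x
  polar-swappable unary x y = trans (+-identityʳ _) (trans (sym (*-identityˡ _)) (*-congʳ (sym (+-identityʳ 1#))))
  polar-swappable {suc m} {A} (swap sw sw′) x y = begin
    trace (A · y) x + polar (A · x) x y
      ≈⟨ +-congˡ (trans (polar-swappable (sw′ x) x y) (*-congˡ (sw x y _))) ⟩
    trace (A · y) x + nat (suc m) * trace (A · y) x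
      ≈⟨ +-congʳ (sym (*-identityˡ _)) ⟩
    1# * trace (A · y) x + nat (suc m) * trace (A · y) x
      ≈⟨ distribʳ _ _ _ ⟨
    nat (suc (suc m)) * trace (A · y) x ∎

  -- Passing from functions on Fin n to vectors

  CoordAdditive : ∀ {n} → Map n → Set (c₁ ⊔ ℓ₂)
  CoordAdditive A = ∀ v i y z → A (v [ i ]≔ (y F.+ z)) ≈ A (v [ i ]≔ y) + A (v [ i ]≔ z)

  CoordCong : ∀ {n} → Map n → Set (c₁ ⊔ ℓ₁ ⊔ ℓ₂)
  CoordCong A = ∀ v w → (∀ i → lookup v i F.≈ lookup w i) → A v ≈ A w

  coordwise-multiAdd : ∀ {n} {A : Map n} → CoordCong A → CoordAdditive A → MultiAdd A
  coordwise-multiAdd {zero}  cg ad = nullary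
  coordwise-multiAdd {suc n} cg ad = curried
    (λ v e → cg _ _ λ { zero → e ; (suc i) → F.refl })
    (λ v y z → ad (y ∷ v) zero y z)
    (λ x → coordwise-multiAdd
      (λ v w e → cg (x ∷ v) (x ∷ w) λ { zero → F.refl ; (suc i) → e i })
      (λ v i y z → ad (x ∷ v) (suc i) y z))

  -- The two vectors are related through their entries, so that no permuted vector has to be built
  -- and the instances are checked index by index.
  CoordSymmetric : ∀ {n} → Map n → Set (c₁ ⊔ ℓ₂)
  CoordSymmetric {n} A = ∀ (π : Permutation′ n) v w → (∀ i → lookup w i ≡ lookup v (π ⟨$⟩ʳ i)) → A w ≈ A v

  coordSymmetric-swappable : ∀ {m} {A : Map (suc m)} → CoordSymmetric A → Swappable A
  coordSymmetric-swappable {zero}  s = unary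
  coordSymmetric-swappable {suc m} s = swap
    (λ x y v → s (Perm.transpose zero (suc zero)) (y ∷ x ∷ v) (x ∷ y ∷ v)
      λ { zero → ≡.refl ; (suc zero) → ≡.refl ; (suc (suc i)) → ≡.refl })
    (λ x → coordSymmetric-swappable
      (λ π v w e → s (Perm.lift₀ π) (x ∷ v) (x ∷ w) λ { zero → ≡.refl ; (suc i) → e i }))

  module FromFunction {n} {A : (Fin n → F.Carrier) → Carrier} (A-sma : SymMultiAdditive F K n A) where

    vec : Map n
    vec v = A (lookup v)

    private
      A-cong = proj₁ A-sma
      A-add  = proj₁ (proj₂ A-sma)
      A-sym  = proj₂ (proj₂ A-sma)

    lookup-update : ∀ (v : Vec F.Carrier n) i y j → lookup (v [ i ]≔ y) j ≡ update F K (lookup v) i y j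
    lookup-update v i y j with j Fin.≟ i
    ... | yes ≡.refl = Vecₚ.lookup∘update j v y
    ... | no  j≢i    = Vecₚ.lookup∘update′ j≢i v y

    vec-multiAdd : MultiAdd vec
    vec-multiAdd = coordwise-multiAdd (λ v w → A-cong _ _) λ v i y z →
      trans (A-cong _ _ (λ j → F.reflexive (lookup-update v i (y F.+ z) j)))
      (trans (A-add (lookup v) i y z)
        (sym (+-cong (A-cong _ _ (λ j → F.reflexive (lookup-update v i y j)))
                     (A-cong _ _ (λ j → F.reflexive (lookup-update v i z j))))))

    vec-symmetric : CoordSymmetric vec
    vec-symmetric π v w e = trans (A-cong _ _ (λ i → F.reflexive (e i))) (A-sym π (lookup v))

    vec-trace : ∀ x → trace vec x ≈ A (λ _ → x)
    vec-trace x = A-cong _ _ (λ i → F.reflexive (Vecₚ.lookup-replicate i x))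

    vec-tabulate : ∀ xs → vec (tabulate xs) ≈ A xs
    vec-tabulate xs = A-cong _ _ (λ i → F.reflexive (Vecₚ.lookup∘tabulate xs i))

  -- Iterated commutators and derivations of higher order

  open Logarithm K field-K char-K

  AdditiveFun : (F.Carrier → Carrier) → Set (c₁ ⊔ ℓ₁ ⊔ ℓ₂)
  AdditiveFun d = CongFun F K d × Additive F K d

  ad : F.Carrier → (F.Carrier → Carrier) → F.Carrier → Carrier
  ad x d y = d (x F.* y) - ι x * d y

  ad-additiveFun : ∀ x {d} → AdditiveFun d → AdditiveFun (ad x d)
  ad-additiveFun x (d-cong , d-+) =
    (λ e → +-cong (d-cong (F.*-congˡ e)) (-‿cong (*-congˡ (d-cong e)))) ,
    (λ y z → trans
      (+-cong (trans (d-cong (F.distribˡ x y z)) (d-+ _ _)) (-‿cong (*-congˡ (d-+ y z))))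
      (solve 5 (λ a b k c d → (a :+ b) :- k :* (c :+ d) := (a :- k :* c) :+ (b :- k :* d)) refl _ _ _ _ _))

  ad-cong : ∀ x {d d′} → (∀ y → d y ≈ d′ y) → ∀ y → ad x d y ≈ ad x d′ y
  ad-cong x e y = +-cong (e _) (-‿cong (*-congˡ (e y)))

  ad-1 : ∀ {d} → CongFun F K d → ∀ y → ad F.1# d y ≈ 0#
  ad-1 d-cong y = x-x≈0 (trans (d-cong (F.*-identityˡ y)) (sym (trans (*-congʳ ι.1-hom) (*-identityˡ _))))

  ad-ι : ∀ x y → ad x ι y ≈ 0#
  ad-ι x y = x-x≈0 (ι.*-hom x y)

  ad-congˡ : ∀ {d} → CongFun F K d → ∀ {x y} → x F.≈ y → ∀ z → ad x d z ≈ ad y d z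
  ad-congˡ d-cong e z = +-cong (d-cong (F.*-congʳ e)) (-‿cong (*-congʳ (ι.cong e)))

  ad-+ : ∀ {d} → AdditiveFun d → ∀ x y z → ad (x F.+ y) d z ≈ ad x d z + 1# * ad y d z
  ad-+ {d} (d-cong , d-+) x y z = begin
    d ((x F.+ y) F.* z) - ι (x F.+ y) * d z
      ≈⟨ +-cong (trans (d-cong (F.distribʳ z x y)) (d-+ _ _)) (-‿cong (*-congʳ (ι.+-hom x y))) ⟩
    (d (x F.* z) + d (y F.* z)) - (ι x + ι y) * d z
      ≈⟨ solve 5 (λ a b p q c → (a :+ b) :- (p :+ q) :* c := (a :- p :* c) :+ (b :- q :* c)) refl _ _ _ _ _ ⟩
    ad x d z + ad y d z
      ≈⟨ +-congˡ (sym (*-identityˡ _)) ⟩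
    ad x d z + 1# * ad y d z ∎

  -- An additive map commutes with multiplication by natural numbers. Thus t enters g (x + t) and
  -- its defect only through powers of ι (x + t).
  ad-+ₙ : ∀ {d} → AdditiveFun d → ∀ x t z → ad (x +ₙ t) d z ≈ ad x d z
  ad-+ₙ {d} D x t z = begin
    ad (x +ₙ t) d z
      ≈⟨ ad-+ D x (FR.nat t) z ⟩
    ad x d z + 1# * (d (FR.nat t F.* z) - ι (FR.nat t) * d z)
      ≈⟨ +-congˡ (x≈0⇒y*x≈0 1# (x-x≈0 (trans (Additivity.additive-nat-* (proj₁ D) (proj₂ D) t z) (*-congʳ (sym (ι-nat t)))))) ⟩
    ad x d z + 0#
      ≈⟨ +-identityʳ _ ⟩
    ad x d z ∎

  ad-comm : ∀ {d} → CongFun F K d → ∀ x y z → ad y (ad x d) z ≈ ad x (ad y d) z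
  ad-comm {d} d-cong x y z = trans
    (solve 6 (λ p q a b c e → (a :- p :* b) :- q :* (c :- p :* e) := (a :- q :* c) :- p :* (b :- q :* e)) refl
      (ι x) (ι y) (d (x F.* (y F.* z))) (d (y F.* z)) (d (x F.* z)) (d z))
    (+-congʳ (+-congʳ (d-cong (FS.solve 3 (λ x y z → x FS.:* (y FS.:* z) FS.:= y FS.:* (x FS.:* z)) F.refl x y z))))

  ad-square : ∀ {d} → CongFun F K d → ∀ x z → ad (x F.* x) d z ≈ ad x (ad x d) z + two * ι x * ad x d z
  ad-square {d} d-cong x z = begin
    d (x F.* x F.* z) - ι (x F.* x) * d z
      ≈⟨ +-cong (d-cong (F.*-assoc x x z)) (-‿cong (*-congʳ (ι.*-hom x x))) ⟩
    d (x F.* (x F.* z)) - ι x * ι x * d z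
      ≈⟨ solve 4 (λ p a b c → a :- p :* p :* c := ((a :- p :* b) :- p :* (b :- p :* c)) :+ con (+ 2) :* p :* (b :- p :* c)) refl
           (ι x) (d (x F.* (x F.* z))) (d (x F.* z)) (d z) ⟩
    ad x (ad x d) z + two * ι x * ad x d z ∎

  -- Allowing a different x in each commutator makes (ad x) ^ r d (u) the trace of an r-additive
  -- map, to which expansion and polarisation apply.
  ads : ∀ r → (F.Carrier → Carrier) → F.Carrier → Map r
  ads zero    d u []      = d u
  ads (suc r) d u (x ∷ v) = ads r (ad x d) u v

  ads-cong : ∀ r {d d′} u → (∀ y → d y ≈ d′ y) → ∀ v → ads r d u v ≈ ads r d′ u v
  ads-cong zero    u e []      = e u
  ads-cong (suc r) u e (x ∷ v) = ads-cong r u (ad-cong x e) v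

  ads-linear : ∀ r d k d′ u v → ads r (λ y → d y + k * d′ y) u v ≈ ads r d u v + k * ads r d′ u v
  ads-linear zero    d k d′ u []      = refl
  ads-linear (suc r) d k d′ u (x ∷ v) = trans
    (ads-cong r u (λ y → solve 6 (λ k p a b c e → (a :+ k :* b) :- p :* (c :+ k :* e) := (a :- p :* c) :+ k :* (b :- p :* e)) refl
      k (ι x) (d (x F.* y)) (d′ (x F.* y)) (d y) (d′ y)) v)
    (ads-linear r (ad x d) k (ad x d′) u v)

  ads-zero : ∀ r {d} u → (∀ y → d y ≈ 0#) → ∀ v → ads r d u v ≈ 0#
  ads-zero zero    u e []      = e u
  ads-zero (suc r) u e (x ∷ v) = ads-zero r u (λ y → x-x≈0 (trans (e _) (sym (x≈0⇒y*x≈0 _ (e y))))) v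

  ads-multiAdd : ∀ r {d} u → AdditiveFun d → MultiAdd (ads r d u)
  ads-multiAdd zero    u D = nullary
  ads-multiAdd (suc r) u D = curried
    (λ v e → ads-cong r u (ad-congˡ (proj₁ D) e) v)
    (λ v x y → trans (ads-cong r u (ad-+ D x y) v) (trans (ads-linear r _ 1# _ u v) (+-congˡ (*-identityˡ _))))
    (λ x → ads-multiAdd r u (ad-additiveFun x D))

  ads-swappable : ∀ r {d} u → AdditiveFun d → Swappable (ads (suc r) d u)
  ads-swappable zero    u D = unary
  ads-swappable (suc r) u D = swap (λ x y → ads-cong r u (ad-comm (proj₁ D) x y))
    (λ x → ads-swappable r u (ad-additiveFun x D))

  adⁿ : ℕ → F.Carrier → (F.Carrier → Carrier) → F.Carrier → Carrier
  adⁿ r x d u = trace (ads r d u) x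

  adⁿ-+ₙ : ∀ r {d} u → AdditiveFun d → ∀ x t → adⁿ r (x +ₙ t) d u ≈ adⁿ r x d u
  adⁿ-+ₙ zero    u D x t = refl
  adⁿ-+ₙ (suc r) u D x t = trans (ads-cong r u (ad-+ₙ D x t) _) (adⁿ-+ₙ r u (ad-additiveFun x D) x t)

  -- Writing s for `ad x` and Y for ι x, ad (x²) is s² + 2 Y s, that is Y² (2 τ + τ²) with τ = s /
  -- Y; hence the r-th power has the coefficients `b r`, homogenised in degree 2 r.
  adⁿ-square : ∀ r {d} u → AdditiveFun d → ∀ x →
    adⁿ r (x F.* x) d u ≈ hev (ι x) (r ℕ.* 2) (λ p → b r p * adⁿ p x d u)
  adⁿ-square zero    u D x = sym (*-identityˡ _)
  adⁿ-square (suc r) {d} u D x = begin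
    adⁿ r (x F.* x) (ad (x F.* x) d) u
      ≈⟨ ads-cong r u (ad-square (proj₁ D) x) _ ⟩
    adⁿ r (x F.* x) (λ y → ad x (ad x d) y + two * Y * ad x d y) u
      ≈⟨ ads-linear r _ (two * Y) _ u _ ⟩
    adⁿ r (x F.* x) (ad x (ad x d)) u + two * Y * adⁿ r (x F.* x) (ad x d) u
      ≈⟨ +-cong (adⁿ-square r u (ad-additiveFun x (ad-additiveFun x D)) x) (*-congˡ (adⁿ-square r u (ad-additiveFun x D) x)) ⟩
    hev Y R (λ p → b r p * θ (suc (suc p))) + two * Y * hev Y R (λ p → b r p * θ (suc p))
      -- Shifted coefficient sequences begin with 0, so both sums can be rewritten over the same
      -- range; the second is one degree short, which uses up the factor Y.
      ≈⟨ +-cong (sym (trans (hev-tail Y (suc R) {w₂} (zeroˡ _)) (hev-tail Y R {λ p → w₂ (suc p)} (zeroˡ _))))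
           (trans (*-assoc two Y _) (*-congˡ (sym (trans (hev-tail Y (suc R) {w₁} (zeroˡ _))
             (hev-suc Y R (x≈0⇒x*y≈0 _ (b-> r (suc R) ℕₚ.≤-refl))))))) ⟩
    hev Y (suc (suc R)) w₂ + two * hev Y (suc (suc R)) w₁
      ≈⟨ +-congˡ (hev-scale Y (suc (suc R)) two w₁) ⟨
    hev Y (suc (suc R)) w₂ + hev Y (suc (suc R)) (λ p → two * w₁ p)
      ≈⟨ hev-+ Y (suc (suc R)) w₂ _ ⟨
    hev Y (suc (suc R)) (λ p → w₂ p + two * w₁ p)
      ≈⟨ hev-congʳ (suc (suc R)) (λ p → solve 4 (λ s₂ w s₁ θ → s₂ :* θ :+ w :* (s₁ :* θ) := (w :* s₁ :+ s₂) :* θ) refl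
           (shift (shift (b r)) p) two (shift (b r) p) (θ p)) ⟩
    hev Y (suc (suc R)) (λ p → b (suc r) p * θ p) ∎
    where
    Y = ι x
    R = r ℕ.* 2
    θ = λ p → adⁿ p x d u
    w₁ = λ p → shift (b r) p * θ p
    w₂ = λ p → shift (shift (b r)) p * θ p

  -- The binomial expansion of (x - ι x) ^ r, where x acts inside the argument of d and ι x outside.
  adⁿ-powers : ∀ r {d} u → CongFun F K d → ∀ x →
    adⁿ r x d u ≈ hev (ι x) r (λ j → β r j * d (pow F x j F.* u))
  adⁿ-powers zero    {d} u d-cong x = trans (d-cong (F.sym (F.*-identityˡ u))) (sym (*-identityˡ _))
  adⁿ-powers (suc r) {d} u d-cong x = begin
    adⁿ r x (ad x d) u
      ≈⟨ adⁿ-powers r u (λ e → +-cong (d-cong (F.*-congˡ e)) (-‿cong (*-congˡ (d-cong e)))) x ⟩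
    hev Y r (λ j → β r j * (d (x F.* (pow F x j F.* u)) - Y * θ j))
      ≈⟨ hev-congʳ r (λ j → trans (*-congˡ (+-congʳ (d-cong (F.sym (F.*-assoc _ _ _)))))
           (solve 4 (λ b t y s → b :* (t :- y :* s) := b :* t :+ (:- y) :* (b :* s)) refl (β r j) (θ (suc j)) Y (θ j))) ⟩
    hev Y r (λ j → β r j * θ (suc j) + - Y * (β r j * θ j))
      ≈⟨ trans (hev-+ Y r _ _) (+-congˡ (hev-scale Y r (- Y) _)) ⟩
    hev Y r (λ j → β r j * θ (suc j)) + - Y * hev Y r (λ j → β r j * θ j)
      ≈⟨ solve 3 (λ a y h → a :+ (:- y) :* h := a :+ (:- con (+ 1)) :* (y :* h)) refl _ Y _ ⟩
    hev Y r (λ j → β r j * θ (suc j)) + - nat 1 * (Y * hev Y r (λ j → β r j * θ j))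
      ≈⟨ +-cong (sym (hev-tail Y r {w} (zeroˡ _))) (*-congˡ (sym (hev-suc Y r (x≈0⇒x*y≈0 _ (β-> r (suc r) ℕₚ.≤-refl))))) ⟩
    hev Y (suc r) w + - nat 1 * hev Y (suc r) (λ j → β r j * θ j)
      ≈⟨ +-congˡ (hev-scale Y (suc r) (- nat 1) _) ⟨
    hev Y (suc r) w + hev Y (suc r) (λ j → - nat 1 * (β r j * θ j))
      ≈⟨ hev-+ Y (suc r) _ _ ⟨
    hev Y (suc r) (λ j → w j + - nat 1 * (β r j * θ j))
      ≈⟨ hev-congʳ (suc r) (λ j → solve 3 (λ s b t → s :* t :+ (:- con (+ 1)) :* (b :* t) := (s :- b) :* t) refl
           (shift (β r) j) (β r j) (θ j)) ⟩
    hev Y (suc r) (λ j → β (suc r) j * θ j) ∎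
    where
    Y = ι x
    θ = λ j → d (pow F x j F.* u)
    w = λ j → shift (β r) j * θ j

  derivation-resp : ∀ m {d d′} → (∀ x → d x ≈ d′ x) → IsDerivation F K ι m d → IsDerivation F K ι m d′
  derivation-resp zero    e (lift d≈0) = lift (λ x → trans (sym (e x)) (d≈0 x))
  derivation-resp (suc m) e (d-cong , d-+ , B , B₁ , B₂ , eq) =
    (λ x≈y → trans (sym (e _)) (trans (d-cong x≈y) (e _))) ,
    (λ x y → trans (sym (e _)) (trans (d-+ x y) (+-cong (e x) (e y)))) ,
    B , B₁ , B₂ ,
    (λ x y → trans (sym (+-cong (+-cong (e _) (-‿cong (*-congˡ (e y)))) (-‿cong (*-congʳ (e x))))) (eq x y))

  derivation-suc : ∀ m {d} → IsDerivation F K ι m d → IsDerivation F K ι (suc m) d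
  derivation-suc zero (lift d≈0) =
    (λ _ → trans (d≈0 _) (sym (d≈0 _))) ,
    (λ x y → trans (d≈0 _) (sym (x≈0∧y≈0⇒x+y≈0 (d≈0 x) (d≈0 y)))) ,
    (λ _ _ → 0#) , (λ _ → lift (λ _ → refl)) , (λ _ → lift (λ _ → refl)) ,
    (λ x y → x-x≈0 (trans (x-x≈0 (trans (d≈0 _) (sym (x≈0⇒y*x≈0 _ (d≈0 y))))) (sym (x≈0⇒x*y≈0 _ (d≈0 x)))))
  derivation-suc (suc m) (d-cong , d-+ , B , B₁ , B₂ , eq) =
    d-cong , d-+ , B , (λ y → derivation-suc m (B₁ y)) , (λ x → derivation-suc m (B₂ x)) , eq

  derivation-+ : ∀ j m {d} → IsDerivation F K ι m d → IsDerivation F K ι (j ℕ.+ m) d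
  derivation-+ zero    m D = D
  derivation-+ (suc j) m D = derivation-suc (j ℕ.+ m) (derivation-+ j m D)

  -- The trace vanishes along the whole line x + t z. Its coefficient of t ^ m is the polar, which
  -- by symmetry is m + 1 times the wanted value.
  adⁿ-polarize : ∀ m {d} u → AdditiveFun d → (∀ x → adⁿ (suc m) x d u ≈ 0#) → ∀ x z → adⁿ m z (ad x d) u ≈ 0#
  adⁿ-polarize m {d} u D vanish x z = *-cancel-0 (char-K m) (begin
    nat (suc m) * adⁿ m z (ad x d) u
      ≈⟨ polar-swappable (ads-swappable m u D) z x ⟨
    polar (ads (suc m) d u) z x
      ≈⟨ top-vanish (polar-top (ads-multiAdd (suc m) u D) x z)
           (λ t → x-x≈0 (trans (vanish _) (sym (x≈0⇒y*x≈0 _ (vanish z))))) ⟩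
    0# ∎)

  -- Here B x = ad x d - d (x) ι, and every commutator kills ι. So polarising the hypothesis gives
  -- it for B x with one commutator fewer, and d (1) = 0 gives B x (1) = 0: the induction applies to
  -- B x.
  adⁿ-derivation : ∀ m d → AdditiveFun d → d F.1# ≈ 0# → (∀ x → adⁿ (suc m) x d F.1# ≈ 0#) → IsDerivation F K ι m d
  adⁿ-derivation zero d (d-cong , d-+) d1 vanish = lift λ x → begin
    d x                              ≈⟨ d-cong (F.*-identityʳ x) ⟨
    d (x F.* F.1#)                   ≈⟨ x-y≈0⇒x≈y (vanish x) ⟩
    ι x * d F.1#                     ≈⟨ x≈0⇒y*x≈0 _ d1 ⟩
    0#                               ∎
  adⁿ-derivation (suc m) d D@(d-cong , d-+) d1 vanish =
    d-cong , d-+ , B , (λ y → derivation-resp m (λ x → B-sym y x) (B-derivation y)) , B-derivation , (λ _ _ → refl)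
    where
    B : F.Carrier → F.Carrier → Carrier
    B x y = d (x F.* y) - ι x * d y - d x * ι y

    B-sym : ∀ x y → B x y ≈ B y x
    B-sym x y = trans (+-congʳ (+-congʳ (d-cong (F.*-comm x y))))
      (solve 5 (λ a p q b c → (a :- p :* b) :- c :* q := (a :- q :* c) :- b :* p) refl (d (y F.* x)) (ι x) (ι y) (d y) (d x))

    B-ad : ∀ x y → ad x d y + - d x * ι y ≈ B x y
    B-ad x y = solve 3 (λ a b c → a :+ (:- b) :* c := a :- b :* c) refl (ad x d y) (d x) (ι y)

    B-additiveFun : ∀ x → AdditiveFun (B x)
    B-additiveFun x =
      (λ e → +-cong (proj₁ (ad-additiveFun x D) e) (-‿cong (*-congˡ (ι.cong e)))) ,
      (λ y z → trans (+-cong (proj₂ (ad-additiveFun x D) y z) (-‿cong (*-congˡ (ι.+-hom y z))))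
        (solve 5 (λ a b k c d → (a :+ b) :- k :* (c :+ d) := (a :- k :* c) :+ (b :- k :* d)) refl _ _ _ _ _))

    B-1 : ∀ x → B x F.1# ≈ 0#
    B-1 x = x-x≈0 (begin
      d (x F.* F.1#) - ι x * d F.1#  ≈⟨ +-cong (d-cong (F.*-identityʳ x)) (-‿cong (x≈0⇒y*x≈0 _ d1)) ⟩
      d x - 0#                       ≈⟨ solve 1 (λ a → a :- con (+ 0) := a) refl (d x) ⟩
      d x                            ≈⟨ *-identityʳ _ ⟨
      d x * 1#                       ≈⟨ *-congˡ ι.1-hom ⟨
      d x * ι F.1#                   ∎)

    B-derivation : ∀ x → IsDerivation F K ι m (B x)
    B-derivation x = adⁿ-derivation m (B x) (B-additiveFun x) (B-1 x) λ z → begin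
      adⁿ (suc m) z (B x) F.1#
        ≈⟨ ads-cong (suc m) F.1# (B-ad x) (replicate (suc m) z) ⟨
      adⁿ (suc m) z (λ y → ad x d y + - d x * ι y) F.1#
        ≈⟨ ads-linear (suc m) (ad x d) (- d x) ι F.1# (replicate (suc m) z) ⟩
      adⁿ (suc m) z (ad x d) F.1# + - d x * adⁿ m z (ad z ι) F.1#
        ≈⟨ x≈0∧y≈0⇒x+y≈0 (adⁿ-polarize (suc m) F.1# D vanish x z) (x≈0⇒y*x≈0 _ (ads-zero m F.1# (ad-ι z) _)) ⟩
      0# ∎

  -- The logarithmic candidate

  -- The degree n truncation of xⁿ a(log(1 + ad x / x)), applied at 1: the candidate for f when κ = 2.
  module LogMonomial {a : F.Carrier → Carrier} (a-add : AdditiveFun a) (a-1 : a F.1# ≈ 0#) where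

    D : ℕ → F.Carrier → Carrier
    D r x = adⁿ r x a F.1#

    g : ℕ → F.Carrier → Carrier
    g n x = hev (ι x) n (λ r → γ r * D r x)

    decomp-g : ∀ n → Decomposition n (g n)
    decomp-g zero    = decomp-const _
    decomp-g (suc n) = decomp-linear (decomp-ι* (decomp-g n)) (γ (suc n)) (trace-decomp (ads-multiAdd (suc n) F.1# a-add))

    comp-0-ads : ∀ n {d} u → CongFun F K d → ∀ x → comp 0 (ads (suc n) d u) x ≈ 0#
    comp-0-ads n u d-cong x = comp-zero 0 x (ads-zero n u (ad-1 d-cong))

    part-0-g : ∀ n x → part (decomp-g n) 0 x ≈ 0#
    part-0-g zero    x = zeroˡ _
    part-0-g (suc n) x = x≈0∧y≈0⇒x+y≈0 (part-0-g n x) (x≈0⇒y*x≈0 _ (comp-0-ads n F.1# (proj₁ a-add) x))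

    -- Since ad 1 = 0, specialising any argument of (ad x) ^ r to 1 gives zero, and only r = 1
    -- reaches part 1. With a = f₁ this makes f and g agree in the one part that κ = 2 leaves free.
    part-1-g : ∀ n x → part (decomp-g (suc n)) 1 x ≈ a x
    part-1-g zero x = begin
      (ι x * (0# * a F.1#) + 0#) + γ 1 * (ad x a F.1# + 0#)
        ≈⟨ +-cong (x≈0∧y≈0⇒x+y≈0 (x≈0⇒y*x≈0 _ (zeroˡ _)) refl) (*-cong γ-1 (+-identityʳ _)) ⟩
      0# + 1# * ad x a F.1#
        ≈⟨ trans (+-identityˡ _) (*-identityˡ _) ⟩
      a (x F.* F.1#) - ι x * a F.1#
        ≈⟨ +-cong (proj₁ a-add (F.*-identityʳ x)) (-‿cong (x≈0⇒y*x≈0 _ a-1)) ⟩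
      a x - 0#
        ≈⟨ solve 1 (λ a → a :- con (+ 0) := a) refl (a x) ⟩
      a x ∎
    part-1-g (suc n) x = begin
      (ι x * part (decomp-g (suc n)) 0 x + part (decomp-g (suc n)) 1 x) +
        γ (suc (suc n)) * (comp 0 (ads (suc n) (ad x a) F.1#) x + comp 1 (ads (suc n) (ad F.1# a) F.1#) x)
        ≈⟨ +-cong (+-cong (x≈0⇒y*x≈0 _ (part-0-g (suc n) x)) (part-1-g n x)) (x≈0⇒y*x≈0 _ (x≈0∧y≈0⇒x+y≈0
             (comp-0-ads n F.1# (proj₁ (ad-additiveFun x a-add)) x)
             (comp-zero 1 x (ads-zero (suc n) F.1# (ad-1 (proj₁ a-add)))))) ⟩
      (0# + a x) + 0#
        ≈⟨ trans (+-identityʳ _) (+-identityˡ _) ⟩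
      a x ∎

    g-square : ∀ n x → g n (x F.* x) ≈ hev (ι x) (n ℕ.* 2) (λ p → logSum b n p * D p x)
    g-square n x = trans
      (hev-cong n (trans (ι.*-hom x x) (*-congˡ (sym (*-identityʳ _)))) (λ r _ → *-congˡ (adⁿ-square r F.1# a-add x)))
      (hev-logSum 2 b-> (ι x) (λ p → D p x) n)

    -- With n = m + 1, g (x²) is a sum of terms in (ι x) ^ (2 n - p) (ad x) ^ p. Those with p up to
    -- n add up to 2 xⁿ g (x) by the identity for the logarithm, and those from n + 1 to 2 n are the
    -- defect.
    defect-g : ∀ m x → defect (suc m) two (g (suc m)) x ≈
      hev (ι x) m (λ j → logSum b (suc m) (j ℕ.+ suc (suc m)) * D (j ℕ.+ suc (suc m)) x)
    defect-g m x = begin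
      g n (x F.* x) - two * pow K Y n * g n x
        ≈⟨ +-congʳ (g-square n x) ⟩
      hev Y (n ℕ.* 2) w - two * pow K Y n * g n x
        ≡⟨ ≡.cong (λ i → hev Y i w - two * pow K Y n * g n x) degrees ⟩
      hev Y (m ℕ.+ suc n) w - two * pow K Y n * g n x
        ≈⟨ +-congʳ (trans (hev-split Y m n w) (+-congʳ (*-congˡ low))) ⟩
      (pow K Y n * (two * g n x) + rest) - two * pow K Y n * g n x
        ≈⟨ solve 4 (λ p w g r → (p :* (w :* g) :+ r) :- w :* p :* g := r) refl (pow K Y n) two (g n x) rest ⟩
      rest ∎
      where
      n = suc m
      Y = ι x
      w = λ p → logSum b n p * D p x
      rest = hev Y m (λ j → w (j ℕ.+ suc n))

      degrees : suc m ℕ.* 2 ≡ m ℕ.+ suc (suc m)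
      degrees = +-*-Solver.solve 1 (λ m → (con′ 1 :+′ m) :*′ con′ 2 :=′ m :+′ (con′ 2 :+′ m)) ≡.refl m
        where open +-*-Solver using () renaming (_:+_ to _:+′_; _:*_ to _:*′_; con to con′; _:=_ to _:=′_)

      low : hev Y n w ≈ two * g n x
      low = trans (hev-cong n refl (λ p p≤n → trans (*-congʳ (logSum-b n p p≤n)) (*-assoc two (γ p) (D p x))))
        (hev-scale Y n two _)

    -- The iterated commutators do not see t, so the term j has t-degree m - j and the top one is j
    -- = 0.
    defect-g-top : ∀ m x → Top m (logSum b (suc m) (suc (suc m)) * D (suc (suc m)) x)
                                 (λ t → defect (suc m) two (g (suc m)) (x +ₙ t))
    defect-g-top m x = top-cong refl
      (λ t → trans (hev-index t) (trans (hev-congʳ m (λ j → *-congˡ (sym (adⁿ-+ₙ (j ℕ.+ suc n) F.1# a-add x t)))) (sym (defect-g m (x +ₙ t)))))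
      (top-degree (≡.trans (ℕₚ.+-identityʳ _) (ℕₚ.*-identityʳ m))
        (hev-top 0 0 m {λ t → ι (x +ₙ t)} {λ j _ → w j} w (top-ι-+ₙ x) (λ _ ())
          (λ j → top-degree (≡.sym (ℕₚ.*-zeroʳ j)) (top-const (w j)))))
      where
      n = suc m
      w = λ j → logSum b n (j ℕ.+ suc n) * D (j ℕ.+ suc n) x

      hev-index : ∀ t → hev (ι (x +ₙ t)) (m ℕ.+ 0) w ≈ hev (ι (x +ₙ t)) m w
      hev-index t = reflexive (≡.cong (λ i → hev (ι (x +ₙ t)) i w) (ℕₚ.+-identityʳ m))

    -- In the variable T = x / ι x the candidate is log (1 + (T - 1)) truncated at degree n;
    -- collecting powers of T gives the constants λ of (iii).
    g-powers : ∀ n x → g n x ≈ sum1to K n (λ j → logSum β n j * pow K (ι x) (n ∸ j) * a (pow F x j))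
    g-powers n x = begin
      hev Y n (λ r → γ r * D r x)
        ≈⟨ hev-cong n (sym (*-identityʳ Y)) (λ r _ → *-congˡ (trans (adⁿ-powers r F.1# (proj₁ a-add) x)
             (trans (hev-congʳ r (λ j → *-congˡ (proj₁ a-add (F.*-identityʳ _))))
                    (reflexive (≡.cong (λ i → hev Y i (λ j → β r j * a (pow F x j))) (≡.sym (ℕₚ.*-identityʳ r))))))) ⟩
      hev (pow K Y 1) n (λ r → γ r * hev Y (r ℕ.* 1) (λ j → β r j * a (pow F x j)))
        ≈⟨ hev-logSum 1 (λ r p l → β-> r p (≡.subst (_< p) (ℕₚ.*-identityʳ r) l)) Y (λ j → a (pow F x j)) n ⟩
      hev Y (n ℕ.* 1) (λ j → logSum β n j * a (pow F x j))
        ≡⟨ ≡.cong (λ i → hev Y i (λ j → logSum β n j * a (pow F x j))) (ℕₚ.*-identityʳ n) ⟩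
      hev Y n (λ j → logSum β n j * a (pow F x j))
        ≈⟨ hev-sum1to Y n (logSum β n) (λ j → a (pow F x j)) a-1 ⟩
      sum1to K n (λ j → logSum β n j * pow K Y (n ∸ j) * a (pow F x j)) ∎
      where Y = ι x

  -- Lowest parts, and the Leibniz defect

  comp-0 : ∀ {n} (A : Map n) x → comp 0 A x ≈ trace A F.1#
  comp-0 {zero}  A x = refl
  comp-0 {suc n} A x = comp-0 (A · F.1#) x

  comp-1-additiveFun : ∀ {n} {A : Map n} → MultiAdd A → AdditiveFun (comp 1 A)
  comp-1-additiveFun nullary = (λ _ → refl) , (λ _ _ → sym (+-identityˡ 0#))
  comp-1-additiveFun {A = A} (curried cg ad M) with comp-1-additiveFun (M F.1#)
  ... | cg′ , ad′ =
    (λ {x} {y} e → +-cong (trans (comp-0 (A · x) x) (trans (cg _ e) (sym (comp-0 (A · y) y)))) (cg′ e)) ,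
    (λ x y → trans
      (+-cong (trans (comp-0 (A · (x F.+ y)) _) (trans (ad _ x y) (+-cong (sym (comp-0 (A · x) x)) (sym (comp-0 (A · y) y))))) (ad′ x y))
      (solve 4 (λ a b c d → (a :+ b) :+ (c :+ d) := (a :+ c) :+ (b :+ d)) refl _ _ _ _))

  comp-1-at-1 : ∀ {n} (A : Map n) → comp 1 A F.1# ≈ nat n * trace A F.1#
  comp-1-at-1 {zero}  A = sym (zeroˡ _)
  comp-1-at-1 {suc n} A = trans (+-cong (trans (comp-0 (A · F.1#) F.1#) (sym (*-identityˡ _))) (comp-1-at-1 (A · F.1#)))
    (sym (distribʳ _ _ _))

  part-0-pow : ∀ n x → part (decomp-pow n) 0 x ≈ 1#
  part-0-pow zero    x = refl
  part-0-pow (suc n) x = part-0-pow n x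

  -- With p and q the n-th powers of x + t and t, one has (x + t) p - t q = x p + t (p - q), so each
  -- step adds one ι x to the coefficient.
  pow-ι-top : ∀ m x → Top m (nat (suc m) * ι x) (λ t → pow K (ι (x +ₙ t)) (suc m) - pow K (nat t) (suc m))
  pow-ι-top zero    x = constant λ t → begin
    ι (x +ₙ t) * 1# - nat t * 1#   ≈⟨ +-cong (*-identityʳ _) (-‿cong (*-identityʳ _)) ⟩
    ι (x +ₙ t) - nat t             ≈⟨ +-congʳ (ι-+ₙ x t) ⟩
    (ι x + nat t) - nat t          ≈⟨ solve 2 (λ a t → (a :+ t) :- t := con (+ 1) :* a) refl (ι x) (nat t) ⟩
    nat 1 * ι x                    ∎
  pow-ι-top (suc m) x = top-cong
    (trans (+-congʳ (*-comm _ _)) (sym (distribʳ _ _ _)))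
    (λ t → trans
      (solve 4 (λ a t p q → a :* p :+ t :* (p :- q) := (a :+ t) :* p :- t :* q) refl
        (ι x) (nat t) (pow K (ι (x +ₙ t)) (suc m)) (pow K (nat t) (suc m)))
      (+-congʳ (*-congʳ (sym (ι-+ₙ x t)))))
    (top-+ (top-scale (ι x) (top-degree (ℕₚ.*-identityʳ (suc m)) (top-pow (suc m) (top-ι-+ₙ x))))
           (top-shift (pow-ι-top m x)))

  multiAdd-sub : ∀ {n} {A B : Map n} k → MultiAdd A → MultiAdd B → MultiAdd (λ v → A v - k * B v)
  multiAdd-sub k nullary            nullary            = nullary
  multiAdd-sub k (curried cg ad M) (curried cg′ ad′ M′) = curried
    (λ v e → +-cong (cg v e) (-‿cong (*-congˡ (cg′ v e))))
    (λ v x y → trans (+-cong (ad v x y) (-‿cong (*-congˡ (ad′ v x y))))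
      (solve 5 (λ a b k c d → (a :+ b) :- k :* (c :+ d) := (a :- k :* c) :+ (b :- k :* d)) refl _ _ _ _ _))
    (λ x → multiAdd-sub k (M x) (M′ x))

  leibnizDefect : ∀ {m} → Map (suc m) → Map (suc (suc m))
  leibnizDefect A (x ∷ y ∷ v) = A (x F.* y ∷ v) - ι x * A (y ∷ v) - ι y * A (x ∷ v)

  leibnizDefect-multiAdd : ∀ {m} {A : Map (suc m)} → MultiAdd A → MultiAdd (leibnizDefect A)
  leibnizDefect-multiAdd {A = A} (curried cg ad M) = curried
    (λ { (y ∷ v) e → +-cong (+-cong (cg v (F.*-congʳ e)) (-‿cong (*-congʳ (ι.cong e)))) (-‿cong (*-congˡ (cg v e))) })
    (λ { (y ∷ v) x x′ → trans
      (+-cong (+-cong (trans (cg v (F.distribʳ y x x′)) (ad v _ _)) (-‿cong (*-congʳ (ι.+-hom x x′)))) (-‿cong (*-congˡ (ad v x x′))))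
      (solve 8 (λ a a′ p p′ b q c c′ → ((a :+ a′) :- (p :+ p′) :* b) :- q :* (c :+ c′) :=
                 (a :- p :* b :- q :* c) :+ (a′ :- p′ :* b :- q :* c′)) refl _ _ _ _ _ _ _ _) })
    (λ x → curried
      (λ v e → +-cong (+-cong (cg v (F.*-congˡ e)) (-‿cong (*-congˡ (cg v e)))) (-‿cong (*-congʳ (ι.cong e))))
      (λ v y y′ → trans
        (+-cong (+-cong (trans (cg v (F.distribˡ x y y′)) (ad v _ _)) (-‿cong (*-congˡ (ad v y y′)))) (-‿cong (*-congʳ (ι.+-hom y y′))))
        (solve 8 (λ a a′ p b b′ q q′ c → ((a :+ a′) :- p :* (b :+ b′)) :- (q :+ q′) :* c :=
                 (a :- p :* b :- q :* c) :+ (a′ :- p :* b′ :- q′ :* c)) refl _ _ _ _ _ _ _ _))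
      (λ y → multiAdd-sub (ι y) (multiAdd-sub (ι x) (M (x F.* y)) (M y)) (M x)))

  -- The four cases

  module Equation (m : ℕ) (κ : Carrier) (f : F.Carrier → Carrier)
    (A : (Fin (suc m) → F.Carrier) → Carrier) (A-sma : SymMultiAdditive F K (suc m) A)
    (f≈A : ∀ x → f x ≈ A (λ _ → x))
    (eq : ∀ x → f (x F.* x) ≈ κ * pow K (ι x) (suc m) * f x) where

    open FromFunction A-sma

    private
      n = suc m

    f-trace : ∀ x → trace vec x ≈ f x
    f-trace x = trans (vec-trace x) (sym (f≈A x))

    decomp-f : Decomposition n f
    decomp-f = decomp-resp f-trace (trace-decomp vec-multiAdd)

    small-f : SmallDefect n κ f
    small-f x = 0 , 0# , s≤s z≤n , constant (λ t → x-x≈0 (eq (x +ₙ t)))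

    part-0-f : ∀ x → part decomp-f 0 x ≈ f F.1#
    part-0-f x = trans (comp-0 vec x) (f-trace F.1#)

    case-generic : (∀ k → k ≤ n → ¬ (κ ≈ pow K two k)) → ∀ x → f x ≈ 0#
    case-generic κ≉ x = trans (sym (part-n decomp-f x))
      (parts-vanish decomp-f small-f 0 (suc n) ℕₚ.≤-refl (λ _ ()) (λ { k _ (s≤s k≤n) → κ≉ k k≤n }) n ℕₚ.≤-refl x)

    -- For κ = 1 the power xⁿ is itself a solution, and its part 0 is 1. So `h` has defect zero and
    -- no part 0, the only part that κ = 2 ^ 0 leaves undetermined.
    case-1 : κ ≈ 1# → ∀ x → f x ≈ f F.1# * pow K (ι x) n
    case-1 κ≈1 x = x-y≈0⇒x≈y (begin
      f x - f F.1# * pow K (ι x) n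
        ≈⟨ solve 3 (λ a c p → a :- c :* p := a :+ (:- c) :* p) refl (f x) (f F.1#) (pow K (ι x) n) ⟩
      h x
        ≈⟨ part-n decomp-h x ⟨
      part decomp-h n x
        ≈⟨ parts-vanish decomp-h small-h 1 (suc n) ℕₚ.≤-refl (λ { zero _ → low ; (suc j) (s≤s ()) })
             (λ k 1≤k _ κ≈2ᵏ → two^-injective-< {0} {k} 1≤k (trans (sym κ≈1) κ≈2ᵏ)) n ℕₚ.≤-refl x ⟩
      0# ∎)
      where
      h = λ x → f x + - f F.1# * pow K (ι x) n

      decomp-h : Decomposition n h
      decomp-h = decomp-linear decomp-f (- f F.1#) (decomp-pow n)

      small-h : SmallDefect n κ h
      small-h x = 0 , 0# , s≤s z≤n , constant (λ t → zero-defect (x +ₙ t))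
        where
        zero-defect : ∀ y → defect n κ h y ≈ 0#
        zero-defect y = begin
          (f (y F.* y) + - c * pow K (ι (y F.* y)) n) - κ * p * (f y + - c * p)
            ≈⟨ +-cong (+-cong (trans (eq y) (*-congʳ (*-congʳ κ≈1))) (*-congˡ (trans (pow-cong n (ι.*-hom y y)) (pow-* (ι y) (ι y) n))))
                 (-‿cong (*-congʳ (*-congʳ κ≈1))) ⟩
          (1# * p * f y + - c * (p * p)) - 1# * p * (f y + - c * p)
            ≈⟨ solve 4 (λ e p f c → (e :* p :* f :+ (:- c) :* (p :* p)) :- e :* p :* (f :+ (:- c) :* p) :=
                 c :* p :* p :* (e :- con (+ 1))) refl 1# p (f y) c ⟩
          c * p * p * (1# - nat 1)
            ≈⟨ x≈0⇒y*x≈0 _ (x-x≈0 (sym (+-identityʳ 1#))) ⟩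
          0# ∎
          where
          c = f F.1#
          p = pow K (ι y) n

      low : (∀ x → part decomp-h 0 x ≈ 0#)
      low x = begin
        part decomp-f 0 x + - f F.1# * part (decomp-pow n) 0 x
          ≈⟨ +-cong (part-0-f x) (*-congˡ (part-0-pow n x)) ⟩
        f F.1# + - f F.1# * 1#
          ≈⟨ +-congˡ (*-identityʳ _) ⟩
        f F.1# - f F.1#
          ≈⟨ -‿inverseʳ _ ⟩
        0# ∎

    module Case-2 (κ≈2 : κ ≈ two) where

      κ≉1 : ¬ (κ ≈ pow K two 0)
      κ≉1 e = two^-injective-< {0} {1} (s≤s z≤n) (trans (sym e) (trans κ≈2 (sym (*-identityʳ two))))

      a : F.Carrier → Carrier
      a = comp 1 vec

      part-0-vanish : ∀ x → part decomp-f 0 x ≈ 0#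
      part-0-vanish = parts-vanish decomp-f small-f 0 1 (s≤s z≤n) (λ _ ()) (λ { zero _ _ → κ≉1 ; (suc k) _ (s≤s ()) }) 0 (s≤s z≤n)

      -- a (1) = n f (1), and f (1) is part 0 of f, which vanishes because κ is not 1.
      a-1 : a F.1# ≈ 0#
      a-1 = trans (comp-1-at-1 vec) (x≈0⇒y*x≈0 _ (trans (sym (comp-0 vec F.1#)) (part-0-vanish F.1#)))

      a-add : AdditiveFun a
      a-add = comp-1-additiveFun vec-multiAdd

      open LogMonomial a-add a-1

      h : F.Carrier → Carrier
      h x = f x + - 1# * g n x

      decomp-h : Decomposition n h
      decomp-h = decomp-linear decomp-f (- 1#) (decomp-g n)

      small-h : SmallDefect n κ h
      small-h x = m , _ , ℕₚ.≤-refl , top-cong refl (λ t → sym (defect-h (x +ₙ t))) (top-scale (- 1#) (defect-g-top m x))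
        where
        defect-h : ∀ y → defect n κ h y ≈ - 1# * defect n two (g n) y
        defect-h y = begin
          (f (y F.* y) + - 1# * g₂) - κ * p * (f y + - 1# * g₁)
            ≈⟨ +-congʳ (+-congʳ (eq y)) ⟩
          (κ * p * f y + - 1# * g₂) - κ * p * (f y + - 1# * g₁)
            ≈⟨ solve 6 (λ k p f e g₁ g₂ → (k :* p :* f :+ e :* g₂) :- k :* p :* (f :+ e :* g₁) :=
                 e :* (g₂ :- k :* p :* g₁)) refl κ p (f y) (- 1#) g₁ g₂ ⟩
          - 1# * (g₂ - κ * p * g₁)
            ≈⟨ *-congˡ (+-congˡ (-‿cong (*-congʳ (*-congʳ κ≈2)))) ⟩
          - 1# * (g₂ - two * p * g₁) ∎
          where
          p = pow K (ι y) n
          g₁ = g n y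
          g₂ = g n (y F.* y)

      u≈v⇒u-v≈0 : ∀ {u v} → u ≈ v → u + - 1# * v ≈ 0#
      u≈v⇒u-v≈0 {u} {v} e = trans (+-cong e (*-congʳ (-‿cong (sym (+-identityʳ 1#)))))
        (solve 1 (λ v → v :+ (:- con (+ 1)) :* v := con (+ 0)) refl v)

      low : ∀ j → j < 2 → ∀ x → part decomp-h j x ≈ 0#
      low zero          _             x = u≈v⇒u-v≈0 (trans (part-0-vanish x) (sym (part-0-g n x)))
      low (suc zero)    _             x = u≈v⇒u-v≈0 (sym (part-1-g m x))
      low (suc (suc j)) (s≤s (s≤s ()))

      f≈g : ∀ x → f x ≈ g n x
      f≈g x = x-y≈0⇒x≈y (begin
        f x - g n x
          ≈⟨ solve 2 (λ a b → a :- b := a :+ (:- con (+ 1)) :* b) refl (f x) (g n x) ⟩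
        f x + - nat 1 * g n x
          ≈⟨ +-congˡ (*-congʳ (-‿cong (+-identityʳ 1#))) ⟩
        h x
          ≈⟨ part-n decomp-h x ⟨
        part decomp-h n x
          ≈⟨ parts-vanish decomp-h small-h 2 (suc n) ℕₚ.≤-refl low
               (λ k 2≤k _ κ≈2ᵏ → two^-injective-< {1} {k} 2≤k (trans (*-identityʳ two) (trans (sym κ≈2) κ≈2ᵏ))) n ℕₚ.≤-refl x ⟩
        0# ∎)

      D-vanish : ∀ x → D (suc n) x ≈ 0#
      D-vanish x = *-cancel-0 (logSum-b-next m) (top-vanish (defect-g-top m x) (λ t → x-x≈0 (begin
        g n ((x +ₙ t) F.* (x +ₙ t))                 ≈⟨ f≈g _ ⟨
        f ((x +ₙ t) F.* (x +ₙ t))                   ≈⟨ eq _ ⟩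
        κ * pow K (ι (x +ₙ t)) n * f (x +ₙ t)       ≈⟨ *-cong (*-congʳ κ≈2) (f≈g _) ⟩
        two * pow K (ι (x +ₙ t)) n * g n (x +ₙ t)   ∎)))

      a-derivation : IsDerivation F K ι (2 ℕ.* suc m ∸ 1) a
      -- The construction gives order n = m + 1; `derivation-+` raises it by m = n - 1, and the
      -- transport matches the unfolded form of 2 n - 1.
      a-derivation = ≡.subst (λ i → IsDerivation F K ι i a) (≡.cong (λ i → m ℕ.+ suc i) (≡.sym (ℕₚ.+-identityʳ m)))
        (derivation-+ m n (adⁿ-derivation n a a-add a-1 D-vanish))

      f-powers : ∀ x → f x ≈ sum1to K n (λ j → logSum β n j * pow K (ι x) (n ∸ j) * a (pow F x j))
      f-powers x = trans (f≈g x) (g-powers n x)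

    module Case-2ⁿ (κ≈2ⁿ : κ ≈ pow K two n) where

      parts-f : ∀ j → j < n → ∀ x → part decomp-f j x ≈ 0#
      parts-f = parts-vanish decomp-f small-f 0 n (ℕₚ.n≤1+n n) (λ _ ())
        (λ k _ k<n κ≈2ᵏ → two^-injective-< k<n (trans (sym κ≈2ᵏ) κ≈2ⁿ))

      f-+ₙ : ∀ x s → f (x +ₙ s) ≈ f x
      f-+ₙ x s = trans (expand decomp-f x s) (trans (hev-last (nat s) n (λ j j<n → parts-f j j<n x)) (part-n decomp-f x))

      -- The coefficients of t ^ (n - 1) in f (x² + 2 t x) = f ((x + t)²) = 2ⁿ (x + t)ⁿ f (x).
      polar-square : ∀ x → pow K two m * polar vec x (x F.* x) ≈ pow K two n * f x * (nat n * ι x)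
      polar-square x = top-unique
        (top-double (polar-top vec-multiAdd (x F.* x) x))
        (top-scale (pow K two n * f x) (pow-ι-top m x))
        (λ t → begin
          trace vec ((x F.* x) +[ 2 ℕ.* t ] x) - pow K (nat (2 ℕ.* t)) n * trace vec x
            ≈⟨ +-cong (f-trace _) (-‿cong (*-cong (trans (pow-cong n (nat-* 2 t)) (pow-* two (nat t) n)) (f-trace x))) ⟩
          f ((x F.* x) +[ 2 ℕ.* t ] x) - pow K two n * pow K (nat t) n * f x
            -- As f ignores natural shifts, the point x² + 2 t x may be completed to (x + t)².
            ≈⟨ +-congʳ (sym (f-+ₙ _ (t ℕ.* t))) ⟩
          f ((x F.* x) +[ 2 ℕ.* t ] x +ₙ (t ℕ.* t)) - pow K two n * pow K (nat t) n * f x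
            ≈⟨ +-congʳ (sym (h-cong decomp-f (+ₙ-square x t))) ⟩
          f ((x +ₙ t) F.* (x +ₙ t)) - pow K two n * pow K (nat t) n * f x
            ≈⟨ +-congʳ (trans (eq _) (*-cong (*-congʳ κ≈2ⁿ) (f-+ₙ x t))) ⟩
          pow K two n * pow K (ι (x +ₙ t)) n * f x - pow K two n * pow K (nat t) n * f x
            ≈⟨ solve 4 (λ w p q f → w :* p :* f :- w :* q :* f := w :* f :* (p :- q)) refl _ _ _ _ ⟩
          pow K two n * f x * (pow K (ι (x +ₙ t)) n - pow K (nat t) n) ∎)

      -- By symmetry the polar at x² is n A (x², x, ..., x); cancelling n and 2 ^ (n - 1) in
      -- `polar-square` leaves a single factor 2.
      leibniz-trace : ∀ x → vec (x F.* x ∷ replicate m x) ≈ two * ι x * f x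
      leibniz-trace x = *-cancelˡ (two^≉0 m) (*-cancelˡ (char-K m) (begin
        nat n * (pow K two m * vec (x F.* x ∷ replicate m x))
          ≈⟨ solve 3 (λ n w v → n :* (w :* v) := w :* (n :* v)) refl (nat n) (pow K two m) _ ⟩
        pow K two m * (nat n * trace (vec · (x F.* x)) x)
          ≈⟨ *-congˡ (polar-swappable (coordSymmetric-swappable vec-symmetric) x (x F.* x)) ⟨
        pow K two m * polar vec x (x F.* x)
          ≈⟨ polar-square x ⟩
        two * pow K two m * f x * (nat n * ι x)
          ≈⟨ solve 5 (λ w p f n i → w :* p :* f :* (n :* i) := n :* (p :* (w :* i :* f))) refl two (pow K two m) (f x) (nat n) (ι x) ⟩
        nat n * (pow K two m * (two * ι x * f x)) ∎))

      leibnizDefect-trace : ∀ x → trace (leibnizDefect vec) x ≈ 0#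
      leibnizDefect-trace x = begin
        vec (x F.* x ∷ replicate m x) - ι x * trace vec x - ι x * trace vec x
          ≈⟨ +-cong (+-cong (leibniz-trace x) (-‿cong (*-congˡ (f-trace x)))) (-‿cong (*-congˡ (f-trace x))) ⟩
        two * ι x * f x - ι x * f x - ι x * f x
          ≈⟨ solve 2 (λ i f → con (+ 2) :* i :* f :- i :* f :- i :* f := con (+ 0)) refl (ι x) (f x) ⟩
        0# ∎

      symmetrized-leibniz : ∀ (xs : Fin (suc (suc m)) → F.Carrier) →
        sumList K (Sym (suc (suc m)))
          (λ σ → A (mulFirstTwo F (λ i → xs (σ i)))
                 - ι (xs (σ zero)) * A (dropFirst F (λ i → xs (σ i)))
                 - ι (xs (σ (suc zero))) * A (dropSecond F (λ i → xs (σ i)))) ≈ 0#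
      symmetrized-leibniz xs = trans
        (sumList-cong (Sym (suc (suc m))) λ σ → sym (+-cong (+-cong
          (vec-tabulate (mulFirstTwo F (xs ∘ σ)))
          (-‿cong (*-congˡ (vec-tabulate (dropFirst F (xs ∘ σ))))))
          (-‿cong (*-congˡ (vec-tabulate (dropSecond F (xs ∘ σ)))))))
        (symmetrization-vanish (leibnizDefect-multiAdd vec-multiAdd) leibnizDefect-trace xs)

theorem2p1 :
  ∀ {c₁ ℓ₁ c₂ ℓ₂ : Level} (F : CommutativeRing c₁ ℓ₁) (K : CommutativeRing c₂ ℓ₂) →
  let module F = CommutativeRing F
      module K = CommutativeRing K
  in
  IsField F → IsField K → CharZero F → CharZero K →
  (ι : F.Carrier → K.Carrier) → IsEmbedding F K ι →
  -- the degree is n = suc m (a positive integer)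
  (m : ℕ) (κ : K.Carrier) (f : F.Carrier → K.Carrier) →
  GenMonomial F K (suc m) f →
  (∀ x → f (x F.* x) K.≈ κ K.* pow K (ι x) (suc m) K.* f x) →
  -- (i)
  ((∀ k → k ≤ suc m → ¬ (κ K.≈ pow K (natC K 2) k)) → ∀ x → f x K.≈ K.0#)
  ×
  -- (ii)
  (κ K.≈ K.1# → ∀ x → f x K.≈ f F.1# K.* pow K (ι x) (suc m))
  ×
  -- (iii)
  (κ K.≈ natC K 2 →
    ∃ λ (a : F.Carrier → K.Carrier) →
      IsDerivation F K ι (2 ℕ.* suc m ∸ 1) a ×
      ∃ λ (lam : ℕ → K.Carrier) →
        ∀ x → f x K.≈ sum1to K (suc m)
                        (λ j → lam j K.* pow K (ι x) (suc m ∸ j) K.* a (pow F x j)))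
  ×
  -- (iv)
  (κ K.≈ pow K (natC K 2) (suc m) →
    ∃ λ (A : (Fin (suc m) → F.Carrier) → K.Carrier) →
      SymMultiAdditive F K (suc m) A ×
      (∀ (xs : Fin (suc (suc m)) → F.Carrier) →
         sumList K (Sym (suc (suc m)))
           (λ σ →
              A (mulFirstTwo F (λ i → xs (σ i)))
              K.- ι (xs (σ zero)) K.* A (dropFirst F (λ i → xs (σ i)))
              K.- ι (xs (σ (suc zero))) K.* A (dropSecond F (λ i → xs (σ i))))
         K.≈ K.0#) ×
      (∀ x → f x K.≈ A (λ _ → x)))
theorem2p1 F K field-F field-K char-F char-K ι emb m κ f (A , A-sma , f≈A) eq =
  case-generic , case-1 ,
  (λ κ≈2 → let open Case-2 κ≈2 in a , a-derivation , logSum β (suc m) , f-powers) ,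
  (λ κ≈2ⁿ → A , A-sma , Case-2ⁿ.symmetrized-leibniz κ≈2ⁿ , f≈A)
  where
  open Extension F K field-K char-K ι emb
  open Logarithm K field-K char-K
  open Equation m κ f A A-sma f≈A eq
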